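{- Let $n=2^a m$ for positive integers $a$ and $m$, with $m$ odd. Then there are at least $(m/e^2)^{n^2}$ latin squares of order $n$ that have no odd plexes.
   Context: A latin square of order $n$ is an $n\times n$ array on $n$ symbols with each symbol occurring exactly once in each row and each column, viewed as a set of entries (row, column, symbol). A $k$-plex is a set of $kn$ entries containing exactly $k$ entries from each row and each column, with each symbol occurring exactly $k$ times. An odd plex is a $k$-plex with $k$ odd. -}

module Defs where

open import Data.Nat using (ℕ; zero; suc; _+_; _*_; _^_; _≤_; _!)
open import Data.Bool using (Bool; true; false; _∧_; if_then_else_)
open import Data.Fin using (Fin; zero; suc)
open import Data.Fin.Properties using (_≟_)
open import Data.Product using (Σ; ∃; _×_)
open import Relation.Nullary using (¬_)
open import Relation.Nullary.Decidable using (⌊_⌋)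
open import Relation.Binary.PropositionalEquality using (_≡_; _≢_)

count : ∀ {n} → (Fin n → Bool) → ℕ
count {zero}  p = 0
count {suc n} p = (if p zero then 1 else 0) + count (λ i → p (suc i))

-- An n×n array on symbols Fin n: cell (i , j) holds symbol L i j.
-- Viewed as a set of entries (row, column, symbol) = {(i, j, L i j)}.
Array : ℕ → Set
Array n = Fin n → Fin n → Fin n

IsLatin : ∀ {n} → Array n → Set
IsLatin {n} L =
  (∀ (i s : Fin n) → count (λ j → ⌊ L i j ≟ s ⌋) ≡ 1) ×
  (∀ (j s : Fin n) → count (λ i → ⌊ L i j ≟ s ⌋) ≡ 1)

sumFin : ∀ {n} → (Fin n → ℕ) → ℕ
sumFin {zero}  f = 0
sumFin {suc n} f = f zero + sumFin (λ i → f (suc i))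

-- A set of entries of L is given by the set of its cells P (P i j = true
-- iff the entry (i, j, L i j) is chosen).  P is a k-plex of L if it has
-- exactly k entries in each row, each column, and of each symbol
-- (hence kn entries in total).
IsPlex : ∀ {n} → Array n → ℕ → (Fin n → Fin n → Bool) → Set
IsPlex {n} L k P =
  (∀ (i : Fin n) → count (λ j → P i j) ≡ k) ×
  (∀ (j : Fin n) → count (λ i → P i j) ≡ k) ×
  (∀ (s : Fin n) → sumFin (λ i → count (λ j → P i j ∧ ⌊ L i j ≟ s ⌋)) ≡ k)

Odd : ℕ → Set
Odd k = ∃ λ t → k ≡ suc (2 * t)

NoOddPlex : ∀ {n} → Array n → Set
NoOddPlex {n} L = ∀ (k : ℕ) (P : Fin n → Fin n → Bool) → Odd k → ¬ IsPlex L k P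

Distinct : ∀ {n} → Array n → Array n → Set
Distinct {n} L L′ = ∃ λ (i : Fin n) → ∃ λ (j : Fin n) → L i j ≢ L′ i j

-- expScaled x K = K! * Σ_{k=0}^{K} x^k / k!  =  Σ_{k=0}^{K} x^k * (K!/k!)
expScaled : ℕ → ℕ → ℕ
expScaled x zero    = 1
expScaled x (suc K) = suc K * expScaled x K + x ^ suc K

-- "N ≥ M / e^x": witnessed by a partial sum of the exponential series,
-- N * Σ_{k≤K} x^k/k! ≥ M  i.e.  M * K! ≤ N * expScaled x K.
AtLeastOverExp : ℕ → ℕ → ℕ → Set
AtLeastOverExp N M x = ∃ λ K → M * K ! ≤ N * expScaled x K

{-# OPTIONS --safe #-}
-- Cut a square of order n = q m, q = 2 ^ a, into q² blocks of order m and fill the block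
-- (b , c) with an arbitrary latin square on the b + c (mod q)-th set of m symbols.  In a
-- k-plex of such a square the block numbers of rows, of columns and of symbols all
-- have the total k m q (q − 1) / 2, so modulo q this total equals twice itself and
-- vanishes, which is impossible when k and m are odd.
--
-- There are ℓ ^ q² such squares, where ℓ is the number of latin squares of order m.  A latin
-- rectangle with k rows is extended by a perfect matching of an (m − k)-regular bipartite
-- graph, and the van der Waerden inequality provides at least (m − k)^m m! / m^m of
-- them.  Hence ℓ ≥ (m!)^(2 m) / m^(m²), and m! ≥ (m / e)^m.
--
-- The van der Waerden inequality comes from Gurvits' capacity argument.  Instead of real
-- stability it uses the Alexandrov–Fenchel inequality for permanents, which follows by the
-- Bochner method of Shenfeld and van Handel.  All inequalities are homogeneous, so they can
-- be stated and proved over the integers.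
module Submission where

open import Defs
open import Data.Bool using (Bool; true; false; _∧_; if_then_else_)
open import Data.Fin using (Fin; zero; suc; toℕ; punchIn; punchOut; combine; quotient; remainder; finToFun; funToFin; _↑ˡ_; _↑ʳ_)
open import Data.Fin.Properties
  using (_≟_; toℕ<n; toℕ-injective; toℕ-fromℕ<; punchInᵢ≢i; punchIn-injective; punchIn-punchOut; remQuot-combine
        ; combine-remQuot; combine-injective; combine-injectiveʳ; funToFin-finToFin; ¬∀⟶∃¬)
import Data.Fin.Properties as Fin
import Data.Integer as ℤ
import Data.Integer.Properties as ℤ
open import Data.List using (List; []; _∷_; [_]; map; length; _++_; replicate; foldr; concat; tabulate; lookup)
open import Data.List.Properties
  using (map-∘; map-id; map-replicate; map-tabulate; ++-identityʳ; length-map; length-++; length-replicate; length-tabulate)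
open import Data.List.Membership.Propositional.Properties using (∈-lookup)
open import Data.List.Relation.Binary.Permutation.Propositional as Perm using (_↭_; ↭-sym; ↭-trans)
open import Data.List.Relation.Binary.Permutation.Propositional.Properties using (shift; ++⁺ˡ)
open import Data.List.Relation.Unary.All as All using (All; []; _∷_)
import Data.List.Relation.Unary.All.Properties as All
open import Data.List.Relation.Unary.AllPairs as AllPairs using (AllPairs; []; _∷_)
import Data.List.Relation.Unary.AllPairs.Properties as AllPairs
open import Data.Nat as ℕ using (ℕ; zero; suc; NonZero; z≤n; s≤s; _!)
import Data.Nat.Properties as ℕ
import Data.Nat.Tactic.RingSolver as ℕ-Solver
open import Data.Product using (∃; _×_; _,_; proj₁; proj₂)
open import Function using (_∘_; id)
open import Relation.Nullary using (Dec; yes; no; contradiction)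
open import Relation.Nullary.Decidable using (⌊_⌋)
open import Relation.Binary.PropositionalEquality
  using (_≡_; _≢_; _≗_; refl; sym; trans; cong; cong₂; subst; subst₂; module ≡-Reasoning)

-- No infimum is ever formed: a lower bound on a capacity is an inequality C * prod xs ≤ K * per
-- (...) for all positive integer vectors `xs`, and by homogeneity integer vectors test as much as
-- rational ones. What stability would give is control of a permanent with k columns u + t v as a
-- polynomial in t; for this the log-concavity in j of the permanents with k - j columns u and j
-- columns v is enough, and that is an instance of Alexandrov-Fenchel. The Bochner method is usually
-- phrased with eigenvalues of a self-adjoint operator. Here a single linear system for a weighted
-- Laplacian is solved up to a positive integer factor, after which only sums of squares are
-- compared. Alexandrov-Fenchel is proved for strictly positive columns, but the matrices of
-- matchings contain zeros; hence the separate perturbation step. The exponents combine as follows: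
-- (m!)^(2m) / m^(m²) with m! ≥ (m/e)^m is (m/e²)^(m²), and the power q² turns m² into n². As e
-- enters only through partial sums of its series, m! ≥ (m/e)^m is replaced by (m y)! ≤ (m!)^y y^(m
-- y) for one suitable y.

module Integers where

  open import Data.Integer using (ℤ; _+_; _*_; _-_; -_; _^_; _≤_; _<_; 0ℤ; 1ℤ; +<+; +≤+; -[1+_]; positive; nonNegative)
  open import Data.Integer.Properties hiding (_≟_)
  open import Data.Integer.Tactic.RingSolver using (solve-∀)
  import Algebra.Properties.Semiring.Sum +-*-semiring as Sum

  -- Permanents

  -- Sums are kept abstract so that unification can recover the summands.
  abstract
    sum : ∀ {n} → (Fin n → ℤ) → ℤ
    sum = Sum.sum

    sum-empty : (f : Fin 0 → ℤ) → sum f ≡ 0ℤ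
    sum-empty f = refl

    sum-suc : ∀ {n} (f : Fin (suc n) → ℤ) → sum f ≡ f zero + sum (f ∘ suc)
    sum-suc f = refl

    sum-cong : ∀ {n} {f g : Fin n → ℤ} → (∀ i → f i ≡ g i) → sum f ≡ sum g
    sum-cong f≗g = Sum.sum-cong-≗ f≗g

    sum-zero : ∀ {n} {f : Fin n → ℤ} → (∀ i → f i ≡ 0ℤ) → sum f ≡ 0ℤ
    sum-zero {n} f≡0 = trans (Sum.sum-cong-≗ f≡0) (Sum.sum-replicate-zero n)

    sum-+ : ∀ {n} (f g : Fin n → ℤ) → sum (λ i → f i + g i) ≡ sum f + sum g
    sum-+ = Sum.∑-distrib-+

    sum-comm : ∀ {m n} (f : Fin m → Fin n → ℤ) →
               sum (λ i → sum (λ j → f i j)) ≡ sum (λ j → sum (λ i → f i j))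
    sum-comm = Sum.∑-comm

    sum-punchIn : ∀ {n} (i : Fin (suc n)) (f : Fin (suc n) → ℤ) → sum f ≡ f i + sum (f ∘ punchIn i)
    sum-punchIn i = Sum.sum-remove {i = i}

    *-sumˡ : ∀ {n} (x : ℤ) (f : Fin n → ℤ) → x * sum f ≡ sum (λ i → x * f i)
    *-sumˡ = Sum.*-distribˡ-sum

  sum-linear : ∀ {n} (α β : ℤ) (f g : Fin n → ℤ) →
               sum (λ i → α * f i + β * g i) ≡ α * sum f + β * sum g
  sum-linear α β f g = trans (sum-+ (λ i → α * f i) (λ i → β * g i))
    (cong₂ _+_ (sym (*-sumˡ α f)) (sym (*-sumˡ β g)))

  -- The matrix is given by its list of columns; the value is 0 if it is not square.
  per : ∀ {n} → List (Fin n → ℤ) → ℤ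
  per {zero}  []       = 1ℤ
  per {zero}  (_ ∷ _)  = 0ℤ
  per {suc n} []       = 0ℤ
  per {suc n} (c ∷ cs) = sum λ i → c i * per (map (_∘ punchIn i) cs)

  per-linear : ∀ {n} (α β : ℤ) {w u v : Fin n → ℤ} (cs : List (Fin n → ℤ)) →
               (∀ i → w i ≡ α * u i + β * v i) →
               per (w ∷ cs) ≡ α * per (u ∷ cs) + β * per (v ∷ cs)
  per-linear {zero} α β cs w≗ = lemma α β
    where
    lemma : ∀ α β → 0ℤ ≡ α * 0ℤ + β * 0ℤ
    lemma = solve-∀
  per-linear {suc n} α β {w} {u} {v} cs w≗ = trans
    (sum-cong λ i → trans (cong (_* m i) (w≗ i)) (lemma α β (u i) (v i) (m i)))
    (sum-linear α β (λ i → u i * m i) (λ i → v i * m i))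
    where
    m : Fin (suc n) → ℤ
    m i = per (map (_∘ punchIn i) cs)
    lemma : ∀ α β u v m → (α * u + β * v) * m ≡ α * (u * m) + β * (v * m)
    lemma = solve-∀

  map-restrict-∘ : ∀ {k l n} (ρ : Fin l → Fin n) (σ : Fin k → Fin l) (cs : List (Fin n → ℤ)) →
                   map (_∘ σ) (map (_∘ ρ) cs) ≡ map (_∘ (ρ ∘ σ)) cs
  map-restrict-∘ ρ σ cs = sym (map-∘ cs)

  -- Deleting the same rows in different orders gives row inclusions that agree pointwise but not
  -- definitionally; the permanent sees only their values.
  per-restrict-cong : ∀ {k n} {ρ σ : Fin k → Fin n} (cs : List (Fin n → ℤ)) → ρ ≗ σ →
                      per (map (_∘ ρ) cs) ≡ per (map (_∘ σ) cs)
  per-restrict-cong {zero}  []       ρ≗σ = refl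
  per-restrict-cong {zero}  (c ∷ cs) ρ≗σ = refl
  per-restrict-cong {suc k} []       ρ≗σ = refl
  per-restrict-cong {suc k} {ρ = ρ} {σ} (c ∷ cs) ρ≗σ = sum-cong λ i → cong₂ _*_
    (cong c (ρ≗σ i))
    (trans (cong per (map-restrict-∘ ρ (punchIn i) cs))
      (trans (per-restrict-cong cs (ρ≗σ ∘ punchIn i))
        (cong per (sym (map-restrict-∘ σ (punchIn i) cs)))))

  lift : ∀ {k n} → (Fin k → Fin n) → Fin (suc k) → Fin (suc n)
  lift ρ zero    = zero
  lift ρ (suc i) = suc (ρ i)

  -- The last argument of h is the inclusion of the indices other than i and k.
  sum-pairs-swap : ∀ {n} (h : (i k : Fin (suc (suc n))) → (Fin n → Fin (suc (suc n))) → ℤ) →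
    (∀ i k {ρ σ} → ρ ≗ σ → h i k ρ ≡ h i k σ) →
    (sum λ i → sum λ j → h i (punchIn i j) (punchIn i ∘ punchIn j)) ≡
    (sum λ i → sum λ j → h (punchIn i j) i (punchIn i ∘ punchIn j))
  sum-pairs-swap {n} h h-cong = trans
    (split λ i j → h i (punchIn i j) (punchIn i ∘ punchIn j))
    (trans (trans (cong (λ B → A + (A′ + B)) (inner h h-cong)) (lemma A A′ B′))
      (sym (split λ i j → h (punchIn i j) i (punchIn i ∘ punchIn j))))
    where
    lemma : ∀ a b c → a + (b + c) ≡ b + (a + c)
    lemma = solve-∀

    -- Pairs with 0 in first place, with 0 in second place, and without 0. The exchange interchanges
    -- the first two sums, and the third is the same claim one dimension lower, where `lift`
    -- restores the row 0 to the inclusion of the kept rows.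
    A A′ B′ : ℤ
    A  = sum λ j → h zero (suc j) (suc ∘ punchIn j)
    A′ = sum λ j → h (suc j) zero (suc ∘ punchIn j)
    B′ = sum λ i → sum λ j → h (punchIn (suc i) (suc j)) (suc i) (punchIn (suc i) ∘ punchIn (suc j))

    split : ∀ (f : (i : Fin (suc (suc n))) → Fin (suc n) → ℤ) → (sum λ i → sum λ j → f i j) ≡
      sum (f zero) + ((sum λ i → f (suc i) zero) + sum λ i → sum λ j → f (suc i) (suc j))
    split f = trans (sum-suc _) (cong (sum (f zero) +_)
      (trans (sum-cong λ i → sum-suc (f (suc i))) (sum-+ (λ i → f (suc i) zero) _)))

    lift-suc : ∀ {m} (i : Fin (suc (suc m))) (j : Fin (suc m)) →
               punchIn (suc i) ∘ punchIn (suc j) ≗ lift (punchIn i ∘ punchIn j)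
    lift-suc i j zero    = refl
    lift-suc i j (suc x) = refl

    lift-cong : ∀ {k m} {ρ σ : Fin k → Fin m} → ρ ≗ σ → lift ρ ≗ lift σ
    lift-cong e zero    = refl
    lift-cong e (suc x) = cong suc (e x)

    inner : ∀ {m} (h : (i k : Fin (suc (suc m))) → (Fin m → Fin (suc (suc m))) → ℤ) →
      (∀ i k {ρ σ} → ρ ≗ σ → h i k ρ ≡ h i k σ) →
      (sum λ i → sum λ j → h (suc i) (punchIn (suc i) (suc j)) (punchIn (suc i) ∘ punchIn (suc j))) ≡
      (sum λ i → sum λ j → h (punchIn (suc i) (suc j)) (suc i) (punchIn (suc i) ∘ punchIn (suc j)))
    inner {zero}  h h-cong = sum-cong λ i → trans (sum-empty _) (sym (sum-empty _))
    inner {suc m} h h-cong = trans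
      (sum-cong λ i → sum-cong λ j → h-cong _ _ (lift-suc i j))
      (trans
        (sum-pairs-swap (λ i k ρ → h (suc i) (suc k) (lift ρ)) (λ i k e → h-cong _ _ (lift-cong e)))
        (sum-cong λ i → sum-cong λ j → sym (h-cong _ _ (lift-suc i j))))

  per-swap : ∀ {n} (x y : Fin n → ℤ) (cs : List (Fin n → ℤ)) → per (x ∷ y ∷ cs) ≡ per (y ∷ x ∷ cs)
  per-swap {zero}        x y cs = refl
  per-swap {suc zero}    x y cs =
    trans (sum-zero λ i → *-zeroʳ (x i)) (sym (sum-zero λ i → *-zeroʳ (y i)))
  per-swap {suc (suc n)} x y cs = trans (expand x y) (trans
    (sum-pairs-swap h λ i k e → cong (x i * y k *_) (per-restrict-cong cs e))
    (trans (sum-cong λ i → sum-cong λ j →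
             cong (_* per (map (_∘ (punchIn i ∘ punchIn j)) cs)) (lemma (x (punchIn i j)) (y i)))
      (sym (expand y x))))
    where
    h : (i k : Fin (suc (suc n))) → (Fin n → Fin (suc (suc n))) → ℤ
    h i k ρ = x i * y k * per (map (_∘ ρ) cs)
    lemma : ∀ a b → a * b ≡ b * a
    lemma = solve-∀
    expand : ∀ x y → per (x ∷ y ∷ cs) ≡
      sum λ i → sum λ j → x i * y (punchIn i j) * per (map (_∘ (punchIn i ∘ punchIn j)) cs)
    expand x y = sum-cong λ i → trans (*-sumˡ (x i) _) (sum-cong λ j → trans
      (sym (*-assoc (x i) (y (punchIn i j)) _))
      (cong (x i * y (punchIn i j) *_) (cong per (map-restrict-∘ (punchIn i) (punchIn j) cs))))

  per-restrict-prep : ∀ {k n} (ρ : Fin k → Fin n) (c : Fin n → ℤ) {cs ds : List (Fin n → ℤ)} →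
    (∀ {l} (σ : Fin l → Fin n) → per (map (_∘ σ) cs) ≡ per (map (_∘ σ) ds)) →
    per (map (_∘ ρ) (c ∷ cs)) ≡ per (map (_∘ ρ) (c ∷ ds))
  per-restrict-prep {zero}  ρ c eq = refl
  per-restrict-prep {suc k} ρ c {cs} {ds} eq = sum-cong λ i → cong (c (ρ i) *_)
    (trans (cong per (map-restrict-∘ ρ (punchIn i) cs))
      (trans (eq (ρ ∘ punchIn i)) (cong per (sym (map-restrict-∘ ρ (punchIn i) ds)))))

  -- Stated for every row map `ρ`, because the `prep` case expands along the common head column and
  -- leaves the tails restricted to fewer rows.
  per-restrict-↭ : ∀ {k n} {cs ds : List (Fin n → ℤ)} → cs ↭ ds →
                   (ρ : Fin k → Fin n) → per (map (_∘ ρ) cs) ≡ per (map (_∘ ρ) ds)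
  per-restrict-↭ Perm.refl         ρ = refl
  per-restrict-↭ (Perm.prep c p)   ρ = per-restrict-prep ρ c (per-restrict-↭ p)
  per-restrict-↭ (Perm.swap {xs} {ys} c d p) ρ = trans
    (per-restrict-prep ρ c {d ∷ xs} {d ∷ ys} λ σ → per-restrict-prep σ d (per-restrict-↭ p))
    (per-swap (c ∘ ρ) (d ∘ ρ) _)
  per-restrict-↭ (Perm.trans p q)  ρ = trans (per-restrict-↭ p ρ) (per-restrict-↭ q ρ)

  per-↭ : ∀ {n} {cs ds : List (Fin n → ℤ)} → cs ↭ ds → per cs ≡ per ds
  per-↭ {cs = cs} {ds} p = trans (cong per (sym (map-id cs)))
    (trans (per-restrict-↭ p id) (cong per (map-id ds)))

  δ : ∀ {n} → Fin n → Fin n → ℤ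
  δ i j with i ≟ j
  ... | yes _ = 1ℤ
  ... | no  _ = 0ℤ

  δ-refl : ∀ {n} (i : Fin n) → δ i i ≡ 1ℤ
  δ-refl i with i ≟ i
  ... | yes _   = refl
  ... | no  i≢i = contradiction refl i≢i

  δ-≢ : ∀ {n} {i j : Fin n} → i ≢ j → δ i j ≡ 0ℤ
  δ-≢ {i = i} {j} i≢j with i ≟ j
  ... | yes i≡j = contradiction i≡j i≢j
  ... | no  _   = refl

  per-δ : ∀ {n} (i : Fin (suc n)) (cs : List (Fin (suc n) → ℤ)) →
          per (δ i ∷ cs) ≡ per (map (_∘ punchIn i) cs)
  per-δ i cs = begin
    sum f                         ≡⟨ sum-punchIn i f ⟩
    f i + sum (f ∘ punchIn i)     ≡⟨ cong₂ _+_ (cong (_* m i) (δ-refl i)) (sum-zero λ j →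
                                       cong (_* m (punchIn i j)) (δ-≢ (punchInᵢ≢i i j ∘ sym))) ⟩
    1ℤ * m i + 0ℤ                 ≡⟨ trans (+-identityʳ _) (*-identityˡ _) ⟩
    m i                           ∎
    where
    open ≡-Reasoning
    m f : Fin _ → ℤ
    m j = per (map (_∘ punchIn j) cs)
    f j = δ i j * m j

  -- Weighted graph Laplacians

  *-nonneg : ∀ {x y} → 0ℤ ≤ x → 0ℤ ≤ y → 0ℤ ≤ x * y
  *-nonneg {x} {y} 0≤x 0≤y = subst (_≤ x * y) (*-zeroʳ x) (*-monoˡ-≤-nonNeg x {{nonNegative 0≤x}} 0≤y)

  *-pos : ∀ {x y} → 0ℤ < x → 0ℤ < y → 0ℤ < x * y
  *-pos {x} {y} 0<x 0<y = subst (_< x * y) (*-zeroʳ x) (*-monoˡ-<-pos x {{positive 0<x}} 0<y)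

  *-mono-≤ˡ : ∀ {x y z} → 0ℤ ≤ x → y ≤ z → x * y ≤ x * z
  *-mono-≤ˡ {x} 0≤x = *-monoˡ-≤-nonNeg x {{nonNegative 0≤x}}

  *-cancel-≤ : ∀ {x y z} → 0ℤ < x → x * y ≤ x * z → y ≤ z
  *-cancel-≤ {x} {y} {z} 0<x = *-cancelˡ-≤-pos y z x {{positive 0<x}}

  square-nonneg : ∀ x → 0ℤ ≤ x * x
  square-nonneg (ℤ.+ n)    = *-nonneg {ℤ.+ n} (+≤+ z≤n) (+≤+ z≤n)
  square-nonneg (-[1+ n ]) = +≤+ z≤n

  -- Reduces an inequality to an identity for the ring solver.
  ≤-by : ∀ {x y d} → 0ℤ ≤ d → y - x ≡ d → x ≤ y
  ≤-by {x} {y} 0≤d eq = 0≤i-j⇒j≤i (subst (0ℤ ≤_) (sym eq) 0≤d)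

  diff : ∀ {x y} → x ≤ y → 0ℤ ≤ y - x
  diff = i≤j⇒0≤j-i

  sum-nonneg : ∀ {n} {f : Fin n → ℤ} → (∀ i → 0ℤ ≤ f i) → 0ℤ ≤ sum f
  sum-nonneg {zero}  {f} 0≤f = ≤-reflexive (sym (sum-empty f))
  sum-nonneg {suc n} {f} 0≤f = subst (0ℤ ≤_) (sym (sum-suc f))
    (+-mono-≤ (0≤f zero) (sum-nonneg (0≤f ∘ suc)))

  sum-pos : ∀ {n} {f : Fin n → ℤ} → (∀ i → 0ℤ ≤ f i) → (i : Fin n) → 0ℤ < f i → 0ℤ < sum f
  sum-pos {suc n} {f} 0≤f i 0<fi = subst (0ℤ <_) (sym (sum-punchIn i f))
    (+-mono-<-≤ 0<fi (sum-nonneg (0≤f ∘ punchIn i)))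

  sum-mono : ∀ {n} {f g : Fin n → ℤ} → (∀ i → f i ≤ g i) → sum f ≤ sum g
  sum-mono {zero}  {f} {g} f≤g = ≤-reflexive (trans (sum-empty f) (sym (sum-empty g)))
  sum-mono {suc n} {f} {g} f≤g = subst₂′ (sum-suc f) (sum-suc g)
    (+-mono-≤ (f≤g zero) (sum-mono (f≤g ∘ suc)))
    where
    subst₂′ : ∀ {a b c d : ℤ} → a ≡ b → c ≡ d → b ≤ d → a ≤ c
    subst₂′ refl refl p = p

  -- Positivity off the diagonal makes the graph complete, hence connected, so the Laplacian kills
  -- only constants and a zero sum is its solvability condition. Loops cancel in the Laplacian but
  -- count towards the degrees `sum (w i)`.
  record PositiveWeights {n} (w : Fin n → Fin n → ℤ) : Set where
    field
      symmetric   : ∀ i j → w i j ≡ w j i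
      nonnegative : ∀ i j → 0ℤ ≤ w i j
      positive′   : ∀ {i j} → i ≢ j → 0ℤ < w i j

  -- Eliminating vertex 0 replaces the other weights by W w i j + w i 0 w 0 j, where W is
  -- the sum of the weights at vertex 0, and these are positive again.
  laplacian-solve : ∀ {n} (w : Fin n → Fin n → ℤ) → PositiveWeights w →
    (f : Fin n → ℤ) → sum f ≡ 0ℤ →
    ∃ λ c → ∃ λ (y : Fin n → ℤ) → 0ℤ < c × (∀ i → sum (λ j → w i j * (y i - y j)) ≡ c * f i)
  laplacian-solve {zero} w pw f Σf≡0 = 1ℤ , (λ ()) , +<+ (s≤s z≤n) , λ ()
  laplacian-solve {suc zero} w pw f Σf≡0 = 1ℤ , (λ _ → 0ℤ) , +<+ (s≤s z≤n) , λ { zero →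
      trans (sum-zero λ j → *-zeroʳ (w zero j)) (sym (trans (*-identityˡ (f zero)) f₀≡0)) }
    where
    f₀≡0 : f zero ≡ 0ℤ
    f₀≡0 = trans (sym (trans (cong (f zero +_) (sum-empty (f ∘ suc))) (+-identityʳ (f zero))))
      (trans (sym (sum-suc f)) Σf≡0)
  laplacian-solve {suc (suc n)} w pw f Σf≡0 with laplacian-solve w′ pw′ f′ Σf′≡0
    where
    open PositiveWeights pw
    v : Fin (suc n) → ℤ
    v j = w zero (suc j)
    W = sum v
    0<v : ∀ j → 0ℤ < v j
    0<v j = positive′ λ ()
    0<W : 0ℤ < W
    0<W = sum-pos (<⇒≤ ∘ 0<v) zero (0<v zero)
    w′ : Fin (suc n) → Fin (suc n) → ℤ
    w′ i j = W * w (suc i) (suc j) + v i * v j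
    f′ : Fin (suc n) → ℤ
    f′ i = W * f (suc i) + f zero * v i
    pw′ : PositiveWeights w′
    pw′ = record
      { symmetric   = λ i j → cong₂ _+_ (cong (W *_) (symmetric (suc i) (suc j))) (*-comm (v i) (v j))
      ; nonnegative = λ i j → +-mono-≤ (*-nonneg (<⇒≤ 0<W) (nonnegative (suc i) (suc j)))
                                (<⇒≤ (*-pos (0<v i) (0<v j)))
      ; positive′   = λ {i} {j} i≢j → +-mono-≤-< (*-nonneg (<⇒≤ 0<W) (nonnegative (suc i) (suc j)))
                                (*-pos (0<v i) (0<v j))
      }
    Σf′≡0 : sum f′ ≡ 0ℤ
    Σf′≡0 = trans (sum-linear W (f zero) (f ∘ suc) v) (trans (lemma W (f zero) (sum (f ∘ suc)))
      (trans (cong (W *_) (trans (sym (sum-suc f)) Σf≡0)) (*-zeroʳ W)))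
      where
      lemma : ∀ W f₀ F → W * F + f₀ * W ≡ W * (f₀ + F)
      lemma = solve-∀
  ... | c , y , 0<c , eq = W * c , y′ , *-pos 0<W 0<c , λ
      { zero → first ; (suc i) → other i }
    where
    open PositiveWeights pw
    open ≡-Reasoning
    v : Fin (suc n) → ℤ
    v j = w zero (suc j)
    W = sum v
    0<W : 0ℤ < W
    0<W = sum-pos (λ j → <⇒≤ (positive′ λ ())) zero (positive′ λ ())
    V = sum λ j → v j * y j
    -- The value at vertex 0 comes from solving its equation W y₀ - W V = W c f₀; the other values
    -- carry a factor W so that no division occurs.
    y′ : Fin (suc (suc n)) → ℤ
    y′ zero    = c * f zero + V
    y′ (suc i) = W * y i

    first : sum (λ j → w zero j * (y′ zero - y′ j)) ≡ W * c * f zero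
    first = begin
      sum (λ j → w zero j * (y′ zero - y′ j))
        ≡⟨ sum-suc _ ⟩
      w zero zero * (y′ zero - y′ zero) + sum (λ j → v j * (y′ zero - W * y j))
        ≡⟨ cong₂ _+_ (lemma₀ (w zero zero) (y′ zero))
             (trans (sum-cong λ j → lemma₁ (v j) (y′ zero) W (y j)) (sum-linear (y′ zero) (- W) v (λ j → v j * y j))) ⟩
      0ℤ + ((c * f zero + V) * W + - W * V)
        ≡⟨ lemma₂ c (f zero) V W ⟩
      W * c * f zero ∎
      where
      lemma₀ : ∀ a b → a * (b - b) ≡ 0ℤ
      lemma₀ = solve-∀
      lemma₁ : ∀ v y₀ W y → v * (y₀ - W * y) ≡ y₀ * v + - W * (v * y)
      lemma₁ = solve-∀
      lemma₂ : ∀ c f V W → 0ℤ + ((c * f + V) * W + - W * V) ≡ W * c * f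
      lemma₂ = solve-∀

    other : ∀ i → sum (λ j → w (suc i) j * (y′ (suc i) - y′ j)) ≡ W * c * f (suc i)
    other i = begin
      sum (λ j → w (suc i) j * (y′ (suc i) - y′ j))
        ≡⟨ sum-suc _ ⟩
      w (suc i) zero * (W * y i - (c * f zero + V)) + sum (λ j → w (suc i) (suc j) * (W * y i - W * y j))
        ≡⟨ cong₂ (λ a b → a * (W * y i - (c * f zero + V)) + b) (symmetric (suc i) zero) main ⟩
      v i * (W * y i - (c * f zero + V)) + (c * (W * f (suc i) + f zero * v i) - v i * (y i * W + - 1ℤ * V))
        ≡⟨ lemma (v i) W (y i) c (f zero) V (f (suc i)) ⟩
      W * c * f (suc i) ∎
      where
      lemma : ∀ v W y c f₀ V f → v * (W * y - (c * f₀ + V)) + (c * (W * f + f₀ * v) - v * (y * W + - 1ℤ * V)) ≡ W * c * f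
      lemma = solve-∀
      lemma₃ : ∀ a W v v′ y y′ → a * (W * y - W * y′) ≡ 1ℤ * ((W * a + v * v′) * (y - y′)) + - v * (y * v′ + - 1ℤ * (v′ * y′))
      lemma₃ = solve-∀
      lemma₄ : ∀ a v b → 1ℤ * a + - v * b ≡ a - v * b
      lemma₄ = solve-∀
      main : sum (λ j → w (suc i) (suc j) * (W * y i - W * y j)) ≡
             c * (W * f (suc i) + f zero * v i) - v i * (y i * W + - 1ℤ * V)
      main = begin
        sum (λ j → w (suc i) (suc j) * (W * y i - W * y j))
          ≡⟨ sum-cong (λ j → lemma₃ (w (suc i) (suc j)) W (v i) (v j) (y i) (y j)) ⟩
        sum (λ j → 1ℤ * ((W * w (suc i) (suc j) + v i * v j) * (y i - y j)) + - v i * (y i * v j + - 1ℤ * (v j * y j)))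
          ≡⟨ sum-linear 1ℤ (- v i) (λ j → (W * w (suc i) (suc j) + v i * v j) * (y i - y j)) (λ j → y i * v j + - 1ℤ * (v j * y j)) ⟩
        1ℤ * sum (λ j → (W * w (suc i) (suc j) + v i * v j) * (y i - y j)) + - v i * sum (λ j → y i * v j + - 1ℤ * (v j * y j))
          ≡⟨ cong₂ (λ a b → 1ℤ * a + - v i * b) (eq i) (sum-linear (y i) (- 1ℤ) v (λ j → v j * y j)) ⟩
        1ℤ * (c * (W * f (suc i) + f zero * v i)) + - v i * (y i * W + - 1ℤ * V)
          ≡⟨ lemma₄ (c * (W * f (suc i) + f zero * v i)) (v i) (y i * W + - 1ℤ * V) ⟩
        c * (W * f (suc i) + f zero * v i) - v i * (y i * W + - 1ℤ * V) ∎

  -- Quadratic forms of a weighted graph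

  form : ∀ {n} → (Fin n → Fin n → ℤ) → (Fin n → ℤ) → (Fin n → ℤ) → ℤ
  form w u v = sum λ i → u i * sum λ j → w i j * v j

  dot : ∀ {n} → (Fin n → ℤ) → (Fin n → ℤ) → (Fin n → ℤ) → ℤ
  dot d u v = sum λ i → d i * (u i * v i)

  form-expand : ∀ {n} (w : Fin n → Fin n → ℤ) (u v : Fin n → ℤ) →
                form w u v ≡ sum λ i → sum λ j → w i j * (u i * v j)
  form-expand w u v = sum-cong λ i → trans (*-sumˡ (u i) (λ j → w i j * v j))
    (sum-cong λ j → lemma (u i) (w i j) (v j))
    where
    lemma : ∀ u w v → u * (w * v) ≡ w * (u * v)
    lemma = solve-∀

  module _ {n} {w : Fin n → Fin n → ℤ} (pw : PositiveWeights w) where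
    open PositiveWeights pw

    private
      d : Fin n → ℤ
      d i = sum (w i)

    form-sym : ∀ u v → form w u v ≡ form w v u
    form-sym u v = begin
      form w u v                                  ≡⟨ form-expand w u v ⟩
      (sum λ i → sum λ j → w i j * (u i * v j))   ≡⟨ sum-comm (λ i j → w i j * (u i * v j)) ⟩
      (sum λ j → sum λ i → w i j * (u i * v j))   ≡⟨ sum-cong (λ j → sum-cong λ i →
                                                       cong₂ _*_ (symmetric i j) (*-comm (u i) (v j))) ⟩
      (sum λ j → sum λ i → w j i * (v j * u i))   ≡⟨ form-expand w v u ⟨
      form w v u                                  ∎
      where open ≡-Reasoning

    form-square-sub : ∀ y z → form w (λ i → y i - z i) (λ i → y i - z i) ≡
                      (form w y y - form w y z) + (form w z z - form w y z)
    form-square-sub y z = begin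
      (sum λ i → (y i - z i) * sum λ j → w i j * (y j - z j))
        ≡⟨ sum-cong (λ i → trans (cong ((y i - z i) *_)
             (trans (sum-cong λ j → lemma₁ (w i j) (y j) (z j)) (sum-linear 1ℤ (- 1ℤ) _ (λ j → w i j * z j))))
             (lemma₂ (y i) (z i) (A i) (B i))) ⟩
      (sum λ i → 1ℤ * (1ℤ * (y i * A i) + - 1ℤ * (y i * B i)) + 1ℤ * (1ℤ * (z i * B i) + - 1ℤ * (z i * A i)))
        ≡⟨ trans (sum-linear 1ℤ 1ℤ (λ i → 1ℤ * (y i * A i) + - 1ℤ * (y i * B i)) _)
             (cong₂ (λ a b → 1ℤ * a + 1ℤ * b) (sum-linear 1ℤ (- 1ℤ) (λ i → y i * A i) (λ i → y i * B i))
               (sum-linear 1ℤ (- 1ℤ) (λ i → z i * B i) (λ i → z i * A i))) ⟩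
      1ℤ * (1ℤ * form w y y + - 1ℤ * form w y z) + 1ℤ * (1ℤ * form w z z + - 1ℤ * form w z y)
        ≡⟨ cong (λ t → 1ℤ * (1ℤ * form w y y + - 1ℤ * form w y z) + 1ℤ * (1ℤ * form w z z + - 1ℤ * t)) (form-sym z y) ⟩
      1ℤ * (1ℤ * form w y y + - 1ℤ * form w y z) + 1ℤ * (1ℤ * form w z z + - 1ℤ * form w y z)
        ≡⟨ lemma₃ (form w y y) (form w y z) (form w z z) ⟩
      (form w y y - form w y z) + (form w z z - form w y z) ∎
      where
      open ≡-Reasoning
      A B : Fin n → ℤ
      A i = sum λ j → w i j * y j
      B i = sum λ j → w i j * z j
      lemma₁ : ∀ w y z → w * (y - z) ≡ 1ℤ * (w * y) + - 1ℤ * (w * z)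
      lemma₁ = solve-∀
      lemma₂ : ∀ y z A B → (y - z) * (1ℤ * A + - 1ℤ * B) ≡
        1ℤ * (1ℤ * (y * A) + - 1ℤ * (y * B)) + 1ℤ * (1ℤ * (z * B) + - 1ℤ * (z * A))
      lemma₂ = solve-∀
      lemma₃ : ∀ a b c → 1ℤ * (1ℤ * a + - 1ℤ * b) + 1ℤ * (1ℤ * c + - 1ℤ * b) ≡ (a - b) + (c - b)
      lemma₃ = solve-∀

    dot-square-sub : ∀ y z → dot d (λ i → y i - z i) (λ i → y i - z i) ≡
                     (dot d y y - dot d y z) + (dot d z z - dot d y z)
    dot-square-sub y z = begin
      dot d (λ i → y i - z i) (λ i → y i - z i)
        ≡⟨ sum-cong (λ i → lemma₂ (d i) (y i) (z i)) ⟩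
      (sum λ i → 1ℤ * (1ℤ * (d i * (y i * y i)) + - 1ℤ * (d i * (y i * z i))) +
                 1ℤ * (1ℤ * (d i * (z i * z i)) + - 1ℤ * (d i * (y i * z i))))
        ≡⟨ trans (sum-linear 1ℤ 1ℤ (λ i → 1ℤ * (d i * (y i * y i)) + - 1ℤ * (d i * (y i * z i))) _)
             (cong₂ (λ a b → 1ℤ * a + 1ℤ * b) (sum-linear 1ℤ (- 1ℤ) (λ i → d i * (y i * y i)) (λ i → d i * (y i * z i)))
               (sum-linear 1ℤ (- 1ℤ) (λ i → d i * (z i * z i)) (λ i → d i * (y i * z i)))) ⟩
      1ℤ * (1ℤ * dot d y y + - 1ℤ * dot d y z) + 1ℤ * (1ℤ * dot d z z + - 1ℤ * dot d y z)
        ≡⟨ lemma₃ (dot d y y) (dot d y z) (dot d z z) ⟩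
      (dot d y y - dot d y z) + (dot d z z - dot d y z) ∎
      where
      open ≡-Reasoning
      lemma₂ : ∀ d y z → d * ((y - z) * (y - z)) ≡
        1ℤ * (1ℤ * (d * (y * y)) + - 1ℤ * (d * (y * z))) + 1ℤ * (1ℤ * (d * (z * z)) + - 1ℤ * (d * (y * z)))
      lemma₂ = solve-∀
      lemma₃ : ∀ a b c → 1ℤ * (1ℤ * a + - 1ℤ * b) + 1ℤ * (1ℤ * c + - 1ℤ * b) ≡ (a - b) + (c - b)
      lemma₃ = solve-∀

    -- Twice the difference of the two sides is the Dirichlet energy Σ wᵢⱼ (uᵢ - uⱼ)². Thus 1 - T is
    -- positive semidefinite for T = D⁻¹ w, D = diag d.
    form≤dot : ∀ u → form w u u ≤ dot d u u
    form≤dot u = *-cancel-≤ {1ℤ + 1ℤ} (+<+ (s≤s z≤n))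
      (≤-by (sum-nonneg λ i → sum-nonneg λ j → *-nonneg (nonnegative i j) (square-nonneg (u i - u j))) (sym identity))
      where
      open ≡-Reasoning
      lemma₁ : ∀ w x y → w * ((x - y) * (x - y)) ≡ 1ℤ * (1ℤ * (w * (x * x)) + 1ℤ * (w * (y * y))) + - (1ℤ + 1ℤ) * (w * (x * y))
      lemma₁ = solve-∀
      lemma₂ : ∀ a b → 1ℤ * (1ℤ * a + 1ℤ * a) + - (1ℤ + 1ℤ) * b ≡ (1ℤ + 1ℤ) * a - (1ℤ + 1ℤ) * b
      lemma₂ = solve-∀
      D₁ : (sum λ i → sum λ j → w i j * (u i * u i)) ≡ dot d u u
      D₁ = sum-cong λ i → trans (sum-cong λ j → *-comm (w i j) (u i * u i))
        (trans (sym (*-sumˡ (u i * u i) (w i))) (*-comm (u i * u i) (d i)))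
      D₂ : (sum λ i → sum λ j → w i j * (u j * u j)) ≡ dot d u u
      D₂ = trans (sum-comm (λ i j → w i j * (u j * u j)))
        (trans (sum-cong λ j → sum-cong λ i → cong (_* (u j * u j)) (symmetric i j)) D₁)
      identity : (sum λ i → sum λ j → w i j * ((u i - u j) * (u i - u j))) ≡
                 (1ℤ + 1ℤ) * dot d u u - (1ℤ + 1ℤ) * form w u u
      identity = begin
        (sum λ i → sum λ j → w i j * ((u i - u j) * (u i - u j)))
          ≡⟨ sum-cong (λ i → trans (sum-cong λ j → lemma₁ (w i j) (u i) (u j))
               (trans (sum-linear 1ℤ (- (1ℤ + 1ℤ)) (λ j → 1ℤ * (w i j * (u i * u i)) + 1ℤ * (w i j * (u j * u j))) (λ j → w i j * (u i * u j)))
                 (cong (λ t → 1ℤ * t + - (1ℤ + 1ℤ) * sum (λ j → w i j * (u i * u j))) (sum-linear 1ℤ 1ℤ (λ j → w i j * (u i * u i)) (λ j → w i j * (u j * u j)))))) ⟩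
        (sum λ i → 1ℤ * (1ℤ * sum (λ j → w i j * (u i * u i)) + 1ℤ * sum (λ j → w i j * (u j * u j)))
                   + - (1ℤ + 1ℤ) * sum (λ j → w i j * (u i * u j)))
          ≡⟨ trans (sum-linear 1ℤ (- (1ℤ + 1ℤ)) (λ i → 1ℤ * sum (λ j → w i j * (u i * u i)) + 1ℤ * sum (λ j → w i j * (u j * u j))) (λ i → sum (λ j → w i j * (u i * u j))))
               (cong (λ t → 1ℤ * t + - (1ℤ + 1ℤ) * sum (λ i → sum (λ j → w i j * (u i * u j)))) (sum-linear 1ℤ 1ℤ (λ i → sum (λ j → w i j * (u i * u i))) (λ i → sum (λ j → w i j * (u j * u j))))) ⟩
        1ℤ * (1ℤ * sum (λ i → sum (λ j → w i j * (u i * u i))) + 1ℤ * sum (λ i → sum (λ j → w i j * (u j * u j))))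
          + - (1ℤ + 1ℤ) * sum (λ i → sum (λ j → w i j * (u i * u j)))
          ≡⟨ cong₂ (λ a b → 1ℤ * a + - (1ℤ + 1ℤ) * b) (cong₂ (λ a b → 1ℤ * a + 1ℤ * b) D₁ D₂) (sym (form-expand w u u)) ⟩
        1ℤ * (1ℤ * dot d u u + 1ℤ * dot d u u) + - (1ℤ + 1ℤ) * form w u u
          ≡⟨ lemma₂ (dot d u u) (form w u u) ⟩
        (1ℤ + 1ℤ) * dot d u u - (1ℤ + 1ℤ) * form w u u ∎

    -- With T = D⁻¹ w (D = diag d) the hypothesis on y and z = (1 − T) y says
    -- ⟨y , T y⟩ ≤ ⟨T y , T y⟩, i.e. no eigenvalue of T lies strictly between 0 and 1.
    -- On the orthogonal complement of the constants 1 − T is positive and invertible,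
    -- so T is nonpositive there.
    form-nonpos : (∀ y z → (∀ i → d i * y i - sum (λ j → w i j * y j) ≡ d i * z i) →
                     form w y y ≤ dot d (λ i → y i - z i) (λ i → y i - z i)) →
                  ∀ z → sum (λ i → d i * z i) ≡ 0ℤ → form w z z ≤ 0ℤ
    form-nonpos gap z Σdz≡0 with laplacian-solve w pw (λ i → d i * z i) Σdz≡0
    ... | c , y , 0<c , eq = *-cancel-≤ {c * c} (*-pos 0<c 0<c)
        (subst₂ _≤_ scale (sym (*-zeroʳ (c * c))) (≤-by (+-mono-≤ (diff psd) (diff gap′))
          (balance Syy Syz Szz Wyy Wyz Wzz Syy-Wyy Syz-Wyz)))
      where
      open ≡-Reasoning
      z′ : Fin n → ℤ
      z′ i = c * z i
      Syy = dot d y y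
      Syz = dot d y z′
      Szz = dot d z′ z′
      Wyy = form w y y
      Wyz = form w y z′
      Wzz = form w z′ z′

      scale : Wzz ≡ c * c * form w z z
      scale = trans (sum-cong λ i → trans
          (cong (c * z i *_) (trans (sum-cong λ j → lemma c (w i j) (z j)) (sym (*-sumˡ c λ j → w i j * z j))))
          (lemma′ c (z i) _))
        (sym (*-sumˡ (c * c) _))
        where
        lemma : ∀ c w z → w * (c * z) ≡ c * (w * z)
        lemma = solve-∀
        lemma′ : ∀ c z s → c * z * (c * s) ≡ c * c * (z * s)
        lemma′ = solve-∀

      lap : ∀ i → d i * y i - sum (λ j → w i j * y j) ≡ d i * z′ i
      lap i = trans (sym (trans
          (trans (sum-cong λ j → lemma (w i j) (y i) (y j)) (sum-linear (y i) (- 1ℤ) (w i) λ j → w i j * y j))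
          (lemma′ (d i) (y i) _)))
        (trans (eq i) (lemma″ c (d i) (z i)))
        where
        lemma : ∀ w y y′ → w * (y - y′) ≡ y * w + - 1ℤ * (w * y′)
        lemma = solve-∀
        lemma′ : ∀ d y s → y * d + - 1ℤ * s ≡ d * y - s
        lemma′ = solve-∀
        lemma″ : ∀ c d z → c * (d * z) ≡ d * (c * z)
        lemma″ = solve-∀

      pair : ∀ u → dot d u y - form w u y ≡ dot d u z′
      pair u = trans (sym (trans
          (trans (sum-cong λ i → lemma (u i) (d i) (y i) _)
            (sum-linear 1ℤ (- 1ℤ) (λ i → d i * (u i * y i)) λ i → u i * sum λ j → w i j * y j))
          (lemma′ (dot d u y) (form w u y))))
        (sum-cong λ i → trans (cong (u i *_) (lap i)) (lemma″ (u i) (d i) (z′ i)))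
        where
        lemma : ∀ u d y s → u * (d * y - s) ≡ 1ℤ * (d * (u * y)) + - 1ℤ * (u * s)
        lemma = solve-∀
        lemma′ : ∀ a b → 1ℤ * a + - 1ℤ * b ≡ a - b
        lemma′ = solve-∀
        lemma″ : ∀ u d z → u * (d * z) ≡ d * (u * z)
        lemma″ = solve-∀

      Syy-Wyy : Syy - Wyy ≡ Syz
      Syy-Wyy = pair y

      Syz-Wyz : Syz - Wyz ≡ Szz
      Syz-Wyz = trans (cong₂ _-_ (sum-cong λ i → cong (d i *_) (*-comm (y i) (z′ i))) (form-sym y z′)) (pair z′)

      gap′ : Wyy ≤ (Syy - Syz) + (Szz - Syz)
      gap′ = subst (Wyy ≤_) (dot-square-sub y z′) (gap y z′ lap)

      psd : (Wyy - Wyz) + (Wzz - Wyz) ≤ (Syy - Syz) + (Szz - Syz)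
      psd = subst₂ _≤_ (form-square-sub y z′) (dot-square-sub y z′) (form≤dot λ i → y i - z′ i)

      -- Since z′ = y - T y and T is self-adjoint for `dot d`, ⟨z′, T z′⟩ = (⟨y, T y⟩ - ⟨T y, T y⟩)
      -- + (⟨T y, T T y⟩ - ⟨T y, T y⟩). The first bracket is nonpositive by `gap′`, the second by
      -- `psd`, that is, by `form≤dot` at y - z′ = T y.
      balance : ∀ Syy Syz Szz Wyy Wyz Wzz → Syy - Wyy ≡ Syz → Syz - Wyz ≡ Szz →
        0ℤ - Wzz ≡ (((Syy - Syz) + (Szz - Syz)) - ((Wyy - Wyz) + (Wzz - Wyz))) +
          (((Syy - Syz) + (Szz - Syz)) - Wyy)
      balance Syy _ _ Wyy Wyz Wzz refl refl = lemma Syy Wyy Wyz Wzz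
        where
        lemma : ∀ Syy Wyy Wyz Wzz → 0ℤ - Wzz ≡
          (((Syy - (Syy - Wyy)) + (((Syy - Wyy) - Wyz) - (Syy - Wyy))) - ((Wyy - Wyz) + (Wzz - Wyz))) +
          (((Syy - (Syy - Wyy)) + (((Syy - Wyy) - Wyz) - (Syy - Wyy))) - Wyy)
        lemma = solve-∀

  -- The Alexandrov–Fenchel inequality

  Pos : ∀ {n} → (Fin n → ℤ) → Set
  Pos v = ∀ i → 0ℤ < v i

  All-restrict : ∀ {k n} (ρ : Fin k → Fin n) {cs : List (Fin n → ℤ)} → All Pos cs → All Pos (map (_∘ ρ) cs)
  All-restrict ρ p = All.map⁺ (All.map (_∘ ρ) p)

  per-pos : ∀ {n} (cs : List (Fin n → ℤ)) → length cs ≡ n → All Pos cs → 0ℤ < per cs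
  per-pos {zero}  []       len p        = +<+ (s≤s z≤n)
  per-pos {suc n} (c ∷ cs) len (p ∷ ps) = sum-pos (<⇒≤ ∘ term) zero (term zero)
    where
    term : ∀ i → 0ℤ < c i * per (map (_∘ punchIn i) cs)
    term i = *-pos (p i) (per-pos _ (trans (length-map (_∘ punchIn i) cs) (ℕ.suc-injective len)) (All-restrict (punchIn i) ps))

  δ-nonneg : ∀ {n} (i j : Fin n) → 0ℤ ≤ δ i j
  δ-nonneg i j with i ≟ j
  ... | yes _ = +≤+ z≤n
  ... | no  _ = ≤-refl

  common-multiple : ∀ {n} (a : Fin n → ℤ) → Pos a →
                    ∃ λ P → ∃ λ (b : Fin n → ℤ) → 0ℤ < P × (∀ i → a i * b i ≡ P)
  common-multiple {zero}  a pa = 1ℤ , (λ ()) , +<+ (s≤s z≤n) , λ ()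
  common-multiple {suc n} a pa with common-multiple (a ∘ suc) (pa ∘ suc)
  ... | P , b , 0<P , eq = a zero * P , b′ , *-pos (pa zero) 0<P , eq′
    where
    b′ : Fin (suc n) → ℤ
    b′ zero    = P
    b′ (suc i) = a zero * b i
    lemma : ∀ a a₀ b → a * (a₀ * b) ≡ a₀ * (a * b)
    lemma = solve-∀
    eq′ : ∀ i → a i * b′ i ≡ a zero * P
    eq′ zero    = refl
    eq′ (suc i) = trans (lemma (a (suc i)) (a zero) (b i)) (cong (a zero *_) (eq i))

  -- Quadratic forms with one positive direction

  module QuadraticForm {n} (Q : (x y : Fin n → ℤ) → ℤ)
    (Q-sym : ∀ x y → Q x y ≡ Q y x)
    (Q-linear : ∀ α β {w u v} y → (∀ i → w i ≡ α * u i + β * v i) → Q w y ≡ α * Q u y + β * Q v y)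
    where

    Q-square : ∀ α β {w} u v → (∀ i → w i ≡ α * u i + β * v i) →
               Q w w ≡ α * α * Q u u + (1ℤ + 1ℤ) * (α * β) * Q u v + β * β * Q v v
    Q-square α β {w} u v eq = trans (Q-linear α β w eq) (trans
      (cong₂ (λ s t → α * s + β * t)
        (trans (Q-sym u w) (Q-linear α β u eq)) (trans (Q-sym v w) (Q-linear α β v eq)))
      (trans (cong (λ t → α * (α * Q u u + β * t) + β * (α * Q u v + β * Q v v)) (Q-sym v u))
        (lemma α β (Q u u) (Q u v) (Q v v))))
      where
      lemma : ∀ α β a b c → α * (α * a + β * b) + β * (α * b + β * c) ≡
              α * α * a + (1ℤ + 1ℤ) * (α * β) * b + β * β * c
      lemma = solve-∀

    -- When `Q a a` is positive, this says that `Q` has Lorentzian signature: exactly one positive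
    -- direction.
    NonposOn⊥ : (Fin n → ℤ) → Set
    NonposOn⊥ a = ∀ x → Q x a ≡ 0ℤ → Q x x ≤ 0ℤ

    -- The reference vector can be exchanged. For x orthogonal to u, the vector y = Q(u,a) x -
    -- Q(x,a) u is orthogonal to a, and Q(y,y) = Q(u,a)² Q(x,x) + Q(x,a)² Q(u,u); so Q(x,x) > 0
    -- would force Q(y,y) > 0.
    nonposOn⊥-change : ∀ {a u} → NonposOn⊥ a → 0ℤ < Q u a → 0ℤ ≤ Q u u → NonposOn⊥ u
    nonposOn⊥-change {a} {u} neg 0<Qua 0≤Quu x Qxu≡0 = *-cancel-≤ (*-pos 0<Qua 0<Qua)
      (subst₂ _≤_ refl (sym (*-zeroʳ (Q u a * Q u a)))
        (≤-trans (≤-by (*-nonneg (square-nonneg (- Q x a)) 0≤Quu) expand) (neg y Qya≡0)))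
      where
      y : Fin n → ℤ
      y i = Q u a * x i + - Q x a * u i
      lemma : ∀ s t → s * t + - t * s ≡ 0ℤ
      lemma = solve-∀
      Qya≡0 : Q y a ≡ 0ℤ
      Qya≡0 = trans (Q-linear (Q u a) (- Q x a) a λ i → refl) (lemma (Q u a) (Q x a))
      lemma′ : ∀ s t q r → (s * s * q + (1ℤ + 1ℤ) * (s * t) * 0ℤ + t * t * r) - s * s * q ≡ t * t * r
      lemma′ = solve-∀
      expand : Q y y - Q u a * Q u a * Q x x ≡ - Q x a * - Q x a * Q u u
      expand = trans (cong (_- Q u a * Q u a * Q x x) (trans (Q-square (Q u a) (- Q x a) x u λ i → refl)
          (cong (λ t → Q u a * Q u a * Q x x + (1ℤ + 1ℤ) * (Q u a * - Q x a) * t + - Q x a * - Q x a * Q u u) Qxu≡0)))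
        (lemma′ (Q u a) (- Q x a) (Q x x) (Q u u))

    -- The hypothesis is applied to the projection of x along u, multiplied by `Q u u` to stay
    -- integral.
    reverse-Cauchy-Schwarz : ∀ {u} → NonposOn⊥ u → 0ℤ < Q u u → ∀ x → Q x x * Q u u ≤ Q x u * Q x u
    reverse-Cauchy-Schwarz {u} neg 0<Quu x = *-cancel-≤ 0<Quu
      (≤-by (diff (neg y Qyu≡0)) (sym expand))
      where
      y : Fin n → ℤ
      y i = Q u u * x i + - Q x u * u i
      lemma : ∀ s t → s * t + - t * s ≡ 0ℤ
      lemma = solve-∀
      Qyu≡0 : Q y u ≡ 0ℤ
      Qyu≡0 = trans (Q-linear (Q u u) (- Q x u) u λ i → refl) (lemma (Q u u) (Q x u))
      lemma′ : ∀ s t q → 0ℤ - (s * s * q + (1ℤ + 1ℤ) * (s * - t) * t + - t * - t * s) ≡ s * (t * t) - s * (q * s)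
      lemma′ = solve-∀
      expand : 0ℤ - Q y y ≡ Q u u * (Q x u * Q x u) - Q u u * (Q x x * Q u u)
      expand = trans (cong (λ t → 0ℤ - t) (Q-square (Q u u) (- Q x u) x u λ i → refl)) (lemma′ (Q u u) (Q x u) (Q x x))

  -- The vector `x` may have entries of either sign. The induction depends on this: the Bochner step
  -- applies the inequality to minors with a vector of unknown signs.
  LogConcave : ∀ {n} → List (Fin n → ℤ) → Set
  LogConcave {n} as = ∀ {u} → Pos u → (x : Fin n → ℤ) →
    per (x ∷ x ∷ as) * per (u ∷ u ∷ as) ≤ per (x ∷ u ∷ as) * per (x ∷ u ∷ as)

  module AlexandrovFenchelStep {n} (a : Fin (3 ℕ.+ n) → ℤ) (as : List (Fin (3 ℕ.+ n) → ℤ))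
    (len : length as ≡ n) (pa : Pos a) (pas : All Pos as)
    (ih : ∀ i → LogConcave (map (_∘ punchIn i) as)) where

    N = 3 ℕ.+ n

    Q : (x y : Fin N → ℤ) → ℤ
    Q x y = per (x ∷ y ∷ a ∷ as)

    open QuadraticForm Q (λ x y → per-swap x y (a ∷ as)) (λ α β y eq → per-linear α β (y ∷ a ∷ as) eq)

    Q-pos : ∀ {x y} → Pos x → Pos y → 0ℤ < Q x y
    Q-pos px py = per-pos _ (cong (3 ℕ.+_) len) (px ∷ py ∷ pa ∷ pas)

    -- Equals `Q (δ i) x`, the i-th coefficient of the linear form Q(·, x).
    q : (x : Fin N → ℤ) → Fin N → ℤ
    q x i = per (map (_∘ punchIn i) (x ∷ a ∷ as))

    q-pos : ∀ {x} → Pos x → ∀ i → 0ℤ < q x i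
    q-pos {x} px i = per-pos _ (trans (length-map (_∘ punchIn i) (x ∷ a ∷ as)) (cong (2 ℕ.+_) len))
      (All-restrict (punchIn i) (px ∷ pa ∷ pas))

    E : Fin N → Fin N → ℤ
    E i j = Q (δ i) (δ j)

    E-minor : Fin N → Fin (2 ℕ.+ n) → ℤ
    E-minor i l = per (map (_∘ punchIn l) (map (_∘ punchIn i) (a ∷ as)))

    E-minor-pos : ∀ i l → 0ℤ < E-minor i l
    E-minor-pos i l = per-pos _ (trans (length-map (_∘ punchIn l) (map (_∘ punchIn i) (a ∷ as)))
        (trans (length-map (_∘ punchIn i) (a ∷ as)) (cong suc len)))
      (All-restrict (punchIn l) (All-restrict (punchIn i) (pa ∷ pas)))

    E-term-nonneg : ∀ i j l → 0ℤ ≤ δ j (punchIn i l) * E-minor i l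
    E-term-nonneg i j l = *-nonneg (δ-nonneg j (punchIn i l)) (<⇒≤ (E-minor-pos i l))

    E-nonneg : ∀ i j → 0ℤ ≤ E i j
    E-nonneg i j = subst (0ℤ ≤_) (sym (per-δ i (δ j ∷ a ∷ as))) (sum-nonneg (E-term-nonneg i j))

    E-pos : ∀ {i j} → i ≢ j → 0ℤ < E i j
    E-pos {i} {j} i≢j = subst (0ℤ <_) (sym (per-δ i (δ j ∷ a ∷ as)))
      (sum-pos (E-term-nonneg i j) (punchOut i≢j)
        (subst (λ t → 0ℤ < t * E-minor i (punchOut i≢j))
          (sym (trans (cong (δ j) (punchIn-punchOut i≢j)) (δ-refl j)))
          (*-pos {1ℤ} (+<+ (s≤s z≤n)) (E-minor-pos i _))))

    q-expand : ∀ x i → q x i ≡ sum λ j → x j * E i j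
    q-expand x i = trans (sym (per-δ i (x ∷ a ∷ as))) (trans (per-swap (δ i) x (a ∷ as))
      (sum-cong λ j → cong (x j *_) (trans (sym (per-δ j (δ i ∷ a ∷ as))) (per-swap (δ j) (δ i) (a ∷ as)))))

    -- Moving `a` to the front and expanding along it writes `Q` as a positive combination of forms
    -- of order one less, to which the induction hypothesis applies.
    Q-expand : ∀ x → Q x x ≡ sum λ i → a i * per (map (_∘ punchIn i) (x ∷ x ∷ as))
    Q-expand x = per-↭ (Perm.trans (Perm.prep x (Perm.swap x a Perm.refl)) (Perm.swap x a Perm.refl))

    -- The form `Q` in the coordinates xᵢ / aᵢ. In them `a` becomes the constant vector 1, which the
    -- normalised operator D⁻¹ w fixes.
    w : Fin N → Fin N → ℤ
    w i j = a i * a j * E i j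

    weights : PositiveWeights w
    weights = record
      { symmetric   = λ i j → cong₂ _*_ (*-comm (a i) (a j)) (per-swap (δ i) (δ j) (a ∷ as))
      ; nonnegative = λ i j → *-nonneg (<⇒≤ (*-pos (pa i) (pa j))) (E-nonneg i j)
      ; positive′   = λ {i} {j} i≢j → *-pos (*-pos (pa i) (pa j)) (E-pos i≢j)
      }

    w-apply : ∀ (y : Fin N → ℤ) i → sum (λ j → w i j * y j) ≡ a i * q (λ j → a j * y j) i
    w-apply y i = trans (sum-cong λ j → lemma (a i) (a j) (E i j) (y j))
      (trans (sym (*-sumˡ (a i) _)) (cong (a i *_) (sym (q-expand (λ j → a j * y j) i))))
      where
      lemma : ∀ a a′ e y → a * a′ * e * y ≡ a * (a′ * y * e)
      lemma = solve-∀

    w-degree : ∀ i → sum (w i) ≡ a i * q a i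
    w-degree i = trans (sum-cong λ j → *-assoc (a i) (a j) (E i j))
      (trans (sym (*-sumˡ (a i) _)) (cong (a i *_) (sym (q-expand a i))))

    w-form : ∀ (y : Fin N → ℤ) → form w y y ≡ Q (λ i → a i * y i) (λ i → a i * y i)
    w-form y = sum-cong λ i → trans (cong (y i *_) (w-apply y i)) (lemma (y i) (a i) _)
      where
      lemma : ∀ y a q → y * (a * q) ≡ a * y * q
      lemma = solve-∀

    -- Summing the induction hypotheses Qᵢ (Y , Y) Qᵢ (a , a) ≤ Qᵢ (Y , a)² over the deleted row i
    -- with weights a i gives the inequality required by form-nonpos.
    gap : ∀ (y z : Fin N → ℤ) → (∀ i → sum (w i) * y i - sum (λ j → w i j * y j) ≡ sum (w i) * z i) →
          form w y y ≤ dot (λ i → sum (w i)) (λ i → y i - z i) (λ i → y i - z i)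
    gap y z eq = subst (_≤ dot (λ i → sum (w i)) Δ Δ) (sym (trans (w-form y) (Q-expand Y))) (sum-mono λ i →
        subst (a i * m i ≤_)
          (trans (lemma (a i) (q a i) (Δ i * Δ i)) (cong (_* (Δ i * Δ i)) (sym (w-degree i))))
          (*-mono-≤ˡ (<⇒≤ (pa i)) (bound i)))
      where
      Δ : Fin N → ℤ
      Δ i = y i - z i
      Y : Fin N → ℤ
      Y i = a i * y i
      m : Fin N → ℤ
      m i = per (map (_∘ punchIn i) (Y ∷ Y ∷ as))
      lemma : ∀ a p s → a * (p * s) ≡ a * p * s
      lemma = solve-∀
      lemma₁ : ∀ a p y z Q → a * p * y - a * Q ≡ a * p * z → a * Q ≡ a * (p * (y - z))
      lemma₁ a p y z Q eq = trans (lemma₂ a p y Q) (trans (cong (λ t → a * p * y - t) eq) (lemma₃ a p y z))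
        where
        lemma₂ : ∀ a p y Q → a * Q ≡ a * p * y - (a * p * y - a * Q)
        lemma₂ = solve-∀
        lemma₃ : ∀ a p y z → a * p * y - a * p * z ≡ a * (p * (y - z))
        lemma₃ = solve-∀
      -- The Laplacian equation with its common factor `a i` removed. It turns the right side of the
      -- induction hypothesis into (q a i)² Δᵢ², against `m i * q a i` on the left, and one factor
      -- `q a i` cancels.
      qY : ∀ i → q Y i ≡ q a i * (y i - z i)
      qY i = *-cancelˡ-≡ (a i) _ _ {{ℤ.>-nonZero (pa i)}} (lemma₁ (a i) (q a i) (y i) (z i) (q Y i)
        (trans (sym (cong₂ (λ s t → s * y i - t) (w-degree i) (w-apply y i))) (trans (eq i) (cong (_* z i) (w-degree i)))))
      lemma₄ : ∀ p s → p * s * (p * s) ≡ p * (p * (s * s))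
      lemma₄ = solve-∀
      bound : ∀ i → m i ≤ q a i * ((y i - z i) * (y i - z i))
      bound i = *-cancel-≤ (q-pos pa i) (subst₂ _≤_ (*-comm (m i) (q a i))
        (trans (cong₂ _*_ (qY i) (qY i)) (lemma₄ (q a i) (y i - z i)))
        (ih i (pa ∘ punchIn i) (Y ∘ punchIn i)))

    nonpos-a : NonposOn⊥ a
    nonpos-a x Qxa≡0 with common-multiple a pa
    ... | P , b , 0<P , ab≡P = *-cancel-≤ (*-pos 0<P 0<P)
      (subst₂ _≤_ (trans (w-form z) square) (sym (*-zeroʳ (P * P))) (form-nonpos weights gap z orthogonal))
      where
      -- This is P x / a, the vector `x` in the coordinates of `w`, cleared of denominators. The
      -- condition Σ d z = 0 becomes P Q(x,a) = 0.
      z : Fin N → ℤ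
      z i = x i * b i
      lemma : ∀ a q x b → a * q * (x * b) ≡ a * b * (x * q)
      lemma = solve-∀
      orthogonal : sum (λ i → sum (w i) * z i) ≡ 0ℤ
      orthogonal = trans (sum-cong λ i → trans (cong (_* z i) (w-degree i))
          (trans (lemma (a i) (q a i) (x i) (b i)) (cong (_* (x i * q a i)) (ab≡P i))))
        (trans (sym (*-sumˡ P λ i → x i * q a i)) (trans (cong (P *_) Qxa≡0) (*-zeroʳ P)))
      lemma′ : ∀ a x b → a * (x * b) ≡ a * b * x + 0ℤ * x
      lemma′ = solve-∀
      lemma″ : ∀ P q → P * P * q + (1ℤ + 1ℤ) * (P * 0ℤ) * q + 0ℤ * 0ℤ * q ≡ P * P * q
      lemma″ = solve-∀
      square : Q (λ i → a i * z i) (λ i → a i * z i) ≡ P * P * Q x x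
      square = trans
        (Q-square P 0ℤ x x λ i → trans (lemma′ (a i) (x i) (b i)) (cong (λ t → t * x i + 0ℤ * x i) (ab≡P i)))
        (lemma″ P (Q x x))

    logConcave : LogConcave (a ∷ as)
    logConcave {u} pu = reverse-Cauchy-Schwarz {u}
      (nonposOn⊥-change {a} {u} nonpos-a (Q-pos pu pa) (<⇒≤ (Q-pos pu pu))) (Q-pos pu pu)

  alexandrov-fenchel : ∀ n (as : List (Fin (2 ℕ.+ n) → ℤ)) → length as ≡ n → All Pos as → LogConcave as
  alexandrov-fenchel zero    [] len ps {u} pu x = ≤-by (square-nonneg (x₀ * u₁ - x₁ * u₀))
      (trans (cong₂ (λ s t → s * s - t) (value x u) (cong₂ _*_ (value x x) (value u u))) (lemma x₀ x₁ u₀ u₁))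
    where
    x₀ = x zero
    x₁ = x (suc zero)
    u₀ = u zero
    u₁ = u (suc zero)
    lemma : ∀ x₀ x₁ u₀ u₁ → (x₀ * u₁ + x₁ * u₀) * (x₀ * u₁ + x₁ * u₀) - (x₀ * x₁ + x₁ * x₀) * (u₀ * u₁ + u₁ * u₀) ≡
            (x₀ * u₁ - x₁ * u₀) * (x₀ * u₁ - x₁ * u₀)
    lemma = solve-∀
    sum₂ : (f : Fin 2 → ℤ) → sum f ≡ f zero + f (suc zero)
    sum₂ f = trans (sum-suc f) (cong (f zero +_) (trans (sum-suc (f ∘ suc))
      (trans (cong (f (suc zero) +_) (sum-empty _)) (+-identityʳ _))))
    sum₁ : (f : Fin 1 → ℤ) → sum f ≡ f zero
    sum₁ f = trans (sum-suc f) (trans (cong (f zero +_) (sum-empty _)) (+-identityʳ _))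
    value : ∀ x y → per (x ∷ y ∷ []) ≡ x zero * y (suc zero) + x (suc zero) * y zero
    value x y = trans (sum₂ _) (cong₂ _+_
      (cong (x zero *_) (trans (sum₁ _) (*-identityʳ (y (suc zero)))))
      (cong (x (suc zero) *_) (trans (sum₁ _) (*-identityʳ (y zero)))))
  alexandrov-fenchel (suc n) (a ∷ as) len (pa ∷ pas) =
    AlexandrovFenchelStep.logConcave a as (ℕ.suc-injective len) pa pas λ i →
      alexandrov-fenchel n _ (trans (length-map (_∘ punchIn i) as) (ℕ.suc-injective len)) (All-restrict (punchIn i) pas)

  -- The van der Waerden inequality

  ^-pos : ∀ {x} n → 0ℤ < x → 0ℤ < x ^ n
  ^-pos zero    0<x = +<+ (s≤s z≤n)
  ^-pos (suc n) 0<x = *-pos 0<x (^-pos n 0<x)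

  ^-*-distrib : ∀ x y n → (x * y) ^ n ≡ x ^ n * y ^ n
  ^-*-distrib x y zero    = refl
  ^-*-distrib x y (suc n) = trans (cong (x * y *_) (^-*-distrib x y n)) (lemma x y (x ^ n) (y ^ n))
    where
    lemma : ∀ x y X Y → x * y * (X * Y) ≡ x * X * (y * Y)
    lemma = solve-∀

  logConcave : ∀ {N} (as : List (Fin N → ℤ)) → 2 ℕ.+ length as ≡ N → All Pos as → LogConcave as
  logConcave {suc zero}    as ()
  logConcave {suc (suc n)} as eq = alexandrov-fenchel n as (ℕ.suc-injective (ℕ.suc-injective eq))

  -- Up to binomial factors the numbers `G i j` are the coefficients of t ↦ per (u + t v, ..., u + t
  -- v, ds) with k = suc k′ equal columns. Log-concavity puts this polynomial, for t ≥ 0, below D₀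
  -- (1 + t D₁ / D₀)^k, the k-th power of a linear function with the same value and derivative at 0.
  module TwoColumns {N} (u v w : Fin N → ℤ) (ds : List (Fin N → ℤ)) (k′ : ℕ) (α β : ℤ)
    (pu : Pos u) (pv : Pos v) (pds : All Pos ds) (len : suc k′ ℕ.+ length ds ≡ N)
    (0≤α : 0ℤ ≤ α) (0≤β : 0ℤ ≤ β) (w≗ : ∀ i → w i ≡ α * u i + β * v i) where

    cols : ℕ → ℕ → List (Fin N → ℤ)
    cols i j = replicate i u ++ replicate j v ++ ds

    G : ℕ → ℕ → ℤ
    G i j = per (cols i j)

    cols-pos : ∀ i j → All Pos (cols i j)
    cols-pos i j = All.++⁺ (All.replicate⁺ i pu) (All.++⁺ (All.replicate⁺ j pv) pds)

    cols-length : ∀ i j → length (cols i j) ≡ i ℕ.+ j ℕ.+ length ds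
    cols-length i j = trans (length-++ (replicate i u)) (trans
      (cong₂ ℕ._+_ (length-replicate i) (trans (length-++ (replicate j v)) (cong (ℕ._+ length ds) (length-replicate j))))
      (sym (ℕ.+-assoc i j (length ds))))

    G-pos : ∀ i j → i ℕ.+ j ≡ suc k′ → 0ℤ < G i j
    G-pos i j eq = per-pos _ (trans (cols-length i j) (trans (cong (ℕ._+ length ds) eq) len)) (cols-pos i j)

    D₀ D₁ : ℤ
    D₀ = G (suc k′) 0
    D₁ = G k′ 1

    D₀-pos : 0ℤ < D₀
    D₀-pos = G-pos (suc k′) 0 (ℕ.+-identityʳ (suc k′))

    D₁-pos : 0ℤ < D₁
    D₁-pos = G-pos k′ 1 (ℕ.+-comm k′ 1)

    step-suc : ∀ i j → suc (i ℕ.+ suc j) ≡ suc k′ → suc (suc (i ℕ.+ j)) ≡ suc k′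
    step-suc i j eq = trans (cong suc (sym (ℕ.+-suc i j))) eq

    G-logConcave : ∀ i j → suc (suc (i ℕ.+ j)) ≡ suc k′ →
                   G i (2 ℕ.+ j) * G (2 ℕ.+ i) j ≤ G (suc i) (suc j) * G (suc i) (suc j)
    G-logConcave i j eq = subst₂ _≤_
      (cong (_* G (2 ℕ.+ i) j) (per-↭ (↭-sym (↭-trans (shift v (replicate i u) (v ∷ replicate j v ++ ds))
        (Perm.prep v (shift v (replicate i u) (replicate j v ++ ds)))))))
      (cong₂ _*_ mid mid)
      (logConcave (cols i j) (trans (cong (2 ℕ.+_) (cols-length i j)) (trans (cong (ℕ._+ length ds) eq) len))
        (cols-pos i j) pu v)
      where
      mid : per (v ∷ u ∷ cols i j) ≡ G (suc i) (suc j)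
      mid = per-↭ (↭-sym (shift v (u ∷ replicate i u) (replicate j v ++ ds)))

    -- By log-concavity the ratios of `G i (suc j)` to `G (suc i) j` do not increase with j, and D₁
    -- / D₀ is the first of them.
    G-ratio : ∀ j i → i ℕ.+ j ≡ k′ → G i (suc j) * D₀ ≤ D₁ * G (suc i) j
    G-ratio zero i eq with refl ← trans (sym (ℕ.+-identityʳ i)) eq = ≤-refl
    G-ratio (suc j) i eq = *-cancel-≤ (*-pos (G-pos (2 ℕ.+ i) j eq′) (+<+ {0} {1} (s≤s z≤n)))
      (≤-by (+-mono-≤ (*-nonneg (<⇒≤ (G-pos (suc i) (suc j) (cong suc eq))) (diff (G-ratio j (suc i) (trans (sym (ℕ.+-suc i j)) eq))))
                      (*-nonneg (<⇒≤ D₀-pos) (diff (G-logConcave i j eq′))))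
        (lemma (G i (2 ℕ.+ j)) (G (2 ℕ.+ i) j) (G (suc i) (suc j)) D₀ D₁))
      where
      eq′ : suc (suc (i ℕ.+ j)) ≡ suc k′
      eq′ = step-suc i j (cong suc eq)
      lemma : ∀ g₀ g₂ g₁ D₀ D₁ → g₂ * 1ℤ * (D₁ * g₁) - g₂ * 1ℤ * (g₀ * D₀) ≡
        g₁ * (D₁ * g₂ - g₁ * D₀) + D₀ * (g₁ * g₁ - g₀ * g₂)
      lemma = solve-∀

    G-bound : ∀ j i → i ℕ.+ j ≡ suc k′ → G i j * D₀ ^ j ≤ D₀ * D₁ ^ j
    G-bound zero i eq with refl ← trans (sym (ℕ.+-identityʳ i)) eq = ≤-refl
    G-bound (suc j) i eq = ≤-by
      (+-mono-≤ (*-nonneg (<⇒≤ (^-pos j D₀-pos)) (diff (G-ratio j i (ℕ.suc-injective (trans (sym (ℕ.+-suc i j)) eq)))))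
                (*-nonneg (<⇒≤ D₁-pos) (diff (G-bound j (suc i) (trans (sym (ℕ.+-suc i j)) eq)))))
      (lemma (G i (suc j)) (G (suc i) j) D₀ D₁ (D₀ ^ j) (D₁ ^ j))
      where
      lemma : ∀ g g′ D₀ D₁ X Y → D₀ * (D₁ * Y) - g * (D₀ * X) ≡ X * (D₁ * g′ - g * D₀) + D₁ * (D₀ * Y - g′ * X)
      lemma = solve-∀

    -- With θ = D₁ / D₀ the bound is D₀ θ^j (α + β θ)^p. Splitting one column `w` into α u + β v
    -- produces the two summands of one factor α + β θ, so induction on p starts from `G-bound`.
    mixed-bound : ∀ p i j → p ℕ.+ (i ℕ.+ j) ≡ suc k′ →
      per (replicate p w ++ cols i j) * D₀ ^ (p ℕ.+ j) ≤ D₀ * (D₁ ^ j * (α * D₀ + β * D₁) ^ p)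
    mixed-bound zero i j eq = subst (G i j * D₀ ^ j ≤_) (cong (D₀ *_) (sym (*-identityʳ (D₁ ^ j)))) (G-bound j i eq)
    mixed-bound (suc p) i j eq = subst (λ t → t * D₀ ^ (suc p ℕ.+ j) ≤ D₀ * (D₁ ^ j * S ^ suc p)) (sym split)
      (≤-by (+-mono-≤ (*-nonneg (*-nonneg 0≤α (<⇒≤ D₀-pos)) (diff ih₁)) (*-nonneg 0≤β (diff ih₂)))
        (lemma α β Fu Fv D₀ D₁ (D₀ ^ (p ℕ.+ j)) (D₁ ^ j) (S ^ p)))
      where
      S = α * D₀ + β * D₁
      Fu = per (replicate p w ++ cols (suc i) j)
      Fv = per (replicate p w ++ cols i (suc j))
      split : per (replicate (suc p) w ++ cols i j) ≡ α * Fu + β * Fv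
      split = trans (per-linear α β (replicate p w ++ cols i j) w≗) (cong₂ (λ s t → α * s + β * t)
        (per-↭ (↭-sym (shift u (replicate p w) (cols i j))))
        (per-↭ (↭-sym (↭-trans (++⁺ˡ (replicate p w) (shift v (replicate i u) (replicate j v ++ ds)))
          (shift v (replicate p w) (cols i j))))))
      ih₁ : Fu * D₀ ^ (p ℕ.+ j) ≤ D₀ * (D₁ ^ j * S ^ p)
      ih₁ = mixed-bound p (suc i) j (trans (ℕ.+-suc p (i ℕ.+ j)) eq)
      ih₂ : Fv * (D₀ * D₀ ^ (p ℕ.+ j)) ≤ D₀ * (D₁ * D₁ ^ j * S ^ p)
      ih₂ = subst (λ t → Fv * t ≤ D₀ * (D₁ * D₁ ^ j * S ^ p)) (cong (D₀ ^_) (ℕ.+-suc p j))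
        (mixed-bound p i (suc j) (trans (cong (p ℕ.+_) (ℕ.+-suc i j)) (trans (ℕ.+-suc p (i ℕ.+ j)) eq)))
      lemma : ∀ α β Fu Fv D₀ D₁ X Y Z →
        D₀ * (Y * ((α * D₀ + β * D₁) * Z)) - (α * Fu + β * Fv) * (D₀ * X) ≡
        α * D₀ * (D₀ * (Y * Z) - Fu * X) + β * (D₀ * (D₁ * Y * Z) - Fv * (D₀ * X))
      lemma = solve-∀

  prod : List ℤ → ℤ
  prod = foldr _*_ 1ℤ

  prod-scale : ∀ α xs → prod (map (α *_) xs) ≡ α ^ length xs * prod xs
  prod-scale α []       = refl
  prod-scale α (x ∷ xs) = trans (cong (α * x *_) (prod-scale α xs)) (lemma α x (α ^ length xs) (prod xs))
    where
    lemma : ∀ α x A P → α * x * (A * P) ≡ α * A * (x * P)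
    lemma = solve-∀

  comb : ∀ {n} → List ℤ → List (Fin n → ℤ) → Fin n → ℤ
  comb (x ∷ xs) (b ∷ bs) i = x * b i + comb xs bs i
  comb _        _        i = 0ℤ

  comb-scale : ∀ {n} α xs (bs : List (Fin n → ℤ)) i → comb (map (α *_) xs) bs i ≡ α * comb xs bs i
  comb-scale α []       bs       i = sym (*-zeroʳ α)
  comb-scale α (x ∷ xs) []       i = sym (*-zeroʳ α)
  comb-scale α (x ∷ xs) (b ∷ bs) i = trans (cong (λ t → α * x * b i + t) (comb-scale α xs bs i)) (lemma α x (b i) _)
    where
    lemma : ∀ α x b c → α * x * b + α * c ≡ α * (x * b + c)
    lemma = solve-∀

  comb-nonneg : ∀ {n xs} {bs : List (Fin n → ℤ)} → All (0ℤ <_) xs → All Pos bs → ∀ i → 0ℤ ≤ comb xs bs i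
  comb-nonneg []       pbs       i = ≤-refl
  comb-nonneg (p ∷ ps) []        i = ≤-refl
  comb-nonneg (p ∷ ps) (pb ∷ pbs) i = +-mono-≤ (<⇒≤ (*-pos p (pb i))) (comb-nonneg ps pbs i)

  comb-pos : ∀ {n x xs} {b : Fin n → ℤ} {bs} → All (0ℤ <_) (x ∷ xs) → All Pos (b ∷ bs) → Pos (comb (x ∷ xs) (b ∷ bs))
  comb-pos (p ∷ ps) (pb ∷ pbs) i = +-mono-<-≤ (*-pos p (pb i)) (comb-nonneg ps pbs i)

  -- Let p (x) = per (u , … , u , ds) / k! with k copies of u = comb xs bs.  Differentiating
  -- by one of the k variables and setting it to 0 lowers the capacity of p by at most the factor
  -- ((k − 1) / k) ^ (k − 1), because log-concavity bounds p by the k-th power of its tangent.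
  capacity-bound : ∀ {N} (b : Fin N → ℤ) (bs ds : List (Fin N → ℤ)) → length (b ∷ bs) ℕ.+ length ds ≡ N →
    All Pos (b ∷ bs) → All Pos ds → (C K : ℤ) → 0ℤ ≤ K →
    (∀ xs → length xs ≡ length (b ∷ bs) → All (0ℤ <_) xs →
      C * prod xs ≤ K * per (replicate (length (b ∷ bs)) (comb xs (b ∷ bs)) ++ ds)) →
    C ≤ K * ((ℤ.+ length (b ∷ bs)) ^ length (b ∷ bs) * per (b ∷ bs ++ ds))
  capacity-bound b [] ds len pbs pds C K 0≤K hyp = subst₂ _≤_ (*-identityʳ C)
    (cong (K *_) (trans (per-linear 1ℤ 0ℤ {u = b} {v = b} ds λ i → lemma (b i)) (lemma′ (per (b ∷ ds)))))
    (hyp (1ℤ ∷ []) refl (+<+ (s≤s z≤n) ∷ []))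
    where
    lemma : ∀ b → 1ℤ * b + 0ℤ ≡ 1ℤ * b + 0ℤ * b
    lemma = solve-∀
    lemma′ : ∀ p → 1ℤ * p + 0ℤ * p ≡ 1ℤ * 1ℤ * p
    lemma′ = solve-∀
  -- The factor `κ′ ^ k′` put on the left is regained from the recursive call, whose conclusion
  -- carries the same power. The constants telescope and only `κ ^ suc k′` survives.
  capacity-bound {N} b (b₁ ∷ bs) ds len (pb ∷ pbs) pds C K 0≤K hyp = *-cancel-≤ (^-pos {κ′} k′ 0<κ′)
    (subst₂ _≤_ (*-comm C _)
      (trans (cong (λ t → K * κ ^ suc k′ * (κ′ ^ k′ * t)) (per-↭ (shift b rest ds))) (lemma K (κ ^ suc k′) (κ′ ^ k′) _))
      (capacity-bound b₁ bs (b ∷ ds) (trans (ℕ.+-suc k′ (length ds)) len) pbs (pb ∷ pds)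
        (C * κ′ ^ k′) (K * κ ^ suc k′) (*-nonneg 0≤K (<⇒≤ (^-pos {κ} (suc k′) 0<κ))) hyp′))
    where
    rest = b₁ ∷ bs
    k′ = length rest
    κ κ′ : ℤ
    κ  = ℤ.+ suc k′
    κ′ = ℤ.+ k′
    0<κ : 0ℤ < κ
    0<κ = +<+ (s≤s z≤n)
    0<κ′ : 0ℤ < κ′
    0<κ′ = +<+ (s≤s z≤n)
    lemma : ∀ K κk κ′k p → K * κk * (κ′k * p) ≡ κ′k * (K * (κk * p))
    lemma = solve-∀
    hyp′ : ∀ xs → length xs ≡ k′ → All (0ℤ <_) xs →
      C * κ′ ^ k′ * prod xs ≤ K * κ ^ suc k′ * per (replicate k′ (comb xs rest) ++ b ∷ ds)
    hyp′ xs@(x ∷ xs′) lxs pxs = *-cancel-≤ (*-pos D₀-pos (^-pos k′ D₁-pos))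
      (≤-trans (≤-reflexive left) (≤-trans
        (hyp (D₀ ∷ map ((κ′ * D₁) *_) xs) (cong suc (trans (length-map _ xs) lxs))
          (D₀-pos ∷ All.map⁺ (All.map (*-pos (*-pos 0<κ′ D₁-pos)) pxs)))
        (≤-trans (*-mono-≤ˡ 0≤K main) (≤-reflexive (right K D₀ D₁ (κ ^ suc k′) (D₁ ^ k′))))))
      where
      u = comb xs rest
      -- Along u + t b the tangent bound divided by t is D₀ (1 + t D₁ / D₀)^k / t, which is least at
      -- t = D₀ / ((k - 1) D₁). Clearing denominators gives weight (k - 1) D₁ to `u` and D₀ to `b`;
      -- D₀ and D₁ are written out because they are defined only in the module opened below with
      -- these weights as parameters.
      α = κ′ * per (replicate k′ u ++ b ∷ ds)
      β = per (replicate (suc k′) u ++ ds)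
      w = comb (β ∷ map (α *_) xs) (b ∷ rest)
      pu : Pos u
      pu = comb-pos pxs pbs
      swapped : ∀ i → w i ≡ α * u i + β * b i
      swapped i = trans (+-comm (β * b i) _) (cong (_+ β * b i) (comb-scale α xs rest i))
      D₀-pos′ : 0ℤ < β
      D₀-pos′ = per-pos _ (trans (length-++ (replicate (suc k′) u)) (trans (cong (ℕ._+ length ds) (length-replicate (suc k′))) len))
        (All.++⁺ (All.replicate⁺ (suc k′) pu) pds)
      D₁-pos′ : 0ℤ < per (replicate k′ u ++ b ∷ ds)
      D₁-pos′ = per-pos _ (trans (length-++ (replicate k′ u)) (trans (cong (ℕ._+ length (b ∷ ds)) (length-replicate k′))
          (trans (ℕ.+-suc k′ (length ds)) len)))
        (All.++⁺ (All.replicate⁺ k′ pu) (pb ∷ pds))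
      open TwoColumns u b w ds k′ α β pu pb pds len (<⇒≤ (*-pos 0<κ′ D₁-pos′)) (<⇒≤ D₀-pos′) swapped
        using (D₀; D₁; D₀-pos; D₁-pos; mixed-bound)
      lemma₁ : ∀ C D κ P Y → D * Y * (C * κ * P) ≡ C * (D * (κ * Y * P))
      lemma₁ = solve-∀
      left : D₀ * D₁ ^ k′ * (C * κ′ ^ k′ * prod xs) ≡ C * (D₀ * prod (map ((κ′ * D₁) *_) xs))
      left = trans (lemma₁ C D₀ (κ′ ^ k′) (prod xs) (D₁ ^ k′)) (cong (λ t → C * (D₀ * t)) (sym
        (trans (prod-scale (κ′ * D₁) xs) (cong (_* prod xs) (trans (cong ((κ′ * D₁) ^_) lxs) (^-*-distrib κ′ D₁ k′))))))
      right : ∀ K D₀ D₁ κk Y → K * (D₀ * (κk * (D₁ * Y))) ≡ D₀ * Y * (K * κk * D₁)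
      right = solve-∀
      lemma₂ : ∀ D₀ D₁ κ′ → κ′ * D₁ * D₀ + D₀ * D₁ ≡ (1ℤ + κ′) * D₁ * D₀
      lemma₂ = solve-∀
      lemma₃ : ∀ D₀ κk Y X → D₀ * (1ℤ * (κk * Y * X)) ≡ X * (D₀ * (κk * Y))
      lemma₃ = solve-∀
      main : per (replicate (suc k′) w ++ ds) ≤ D₀ * (κ ^ suc k′ * D₁ ^ suc k′)
      main = *-cancel-≤ (^-pos (suc k′) D₀-pos) (subst₂ _≤_
        (trans (cong (λ t → per (replicate (suc k′) w ++ ds) * D₀ ^ t) (ℕ.+-identityʳ (suc k′))) (*-comm _ (D₀ ^ suc k′)))
        (trans (cong (λ t → D₀ * (1ℤ * t)) (trans (cong (_^ suc k′) (lemma₂ D₀ D₁ κ′))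
            (trans (^-*-distrib ((1ℤ + κ′) * D₁) D₀ (suc k′)) (cong (_* D₀ ^ suc k′) (^-*-distrib (1ℤ + κ′) D₁ (suc k′))))))
          (lemma₃ D₀ (κ ^ suc k′) (D₁ ^ suc k′) (D₀ ^ suc k′)))
        (mixed-bound (suc k′) 0 0 (ℕ.+-identityʳ (suc k′))))

  -- Products over rows and the inequality of arithmetic and geometric means

  ∏ : ∀ {n} → (Fin n → ℤ) → ℤ
  ∏ {zero}  f = 1ℤ
  ∏ {suc n} f = f zero * ∏ (f ∘ suc)

  ∏-punchIn : ∀ {n} (i : Fin (suc n)) (f : Fin (suc n) → ℤ) → ∏ f ≡ f i * ∏ (f ∘ punchIn i)
  ∏-punchIn zero f = refl
  ∏-punchIn {suc n} (suc i) f = trans (cong (f zero *_) (∏-punchIn i (f ∘ suc))) (lemma (f zero) (f (suc i)) _)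
    where
    lemma : ∀ a b c → a * (b * c) ≡ b * (a * c)
    lemma = solve-∀

  ∏-* : ∀ {n} (f g : Fin n → ℤ) → ∏ (λ i → f i * g i) ≡ ∏ f * ∏ g
  ∏-* {zero}  f g = refl
  ∏-* {suc n} f g = trans (cong (f zero * g zero *_) (∏-* (f ∘ suc) (g ∘ suc))) (lemma (f zero) (g zero) _ _)
    where
    lemma : ∀ a b c d → a * b * (c * d) ≡ a * c * (b * d)
    lemma = solve-∀

  ∏-const : ∀ n x → ∏ {n} (λ _ → x) ≡ x ^ n
  ∏-const zero    x = refl
  ∏-const (suc n) x = cong (x *_) (∏-const n x)

  ∏-^ : ∀ {n} (f : Fin n → ℤ) k → ∏ (λ i → f i ^ k) ≡ ∏ f ^ k
  ∏-^ {zero}  f k = sym (^-zeroˡ k)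
  ∏-^ {suc n} f k = trans (cong (f zero ^ k *_) (∏-^ (f ∘ suc) k)) (sym (^-*-distrib (f zero) (∏ (f ∘ suc)) k))

  ∏-^-sum : ∀ {n} x (e : Fin n → ℕ) → ∏ (λ i → x ^ e i) ≡ x ^ sumFin e
  ∏-^-sum {zero}  x e = refl
  ∏-^-sum {suc n} x e = trans (cong (x ^ e zero *_) (∏-^-sum x (e ∘ suc))) (sym (^-distribˡ-+-* x (e zero) _))

  ∏-nonneg : ∀ {n} {f : Fin n → ℤ} → (∀ i → 0ℤ ≤ f i) → 0ℤ ≤ ∏ f
  ∏-nonneg {zero}  0≤f = +≤+ z≤n
  ∏-nonneg {suc n} 0≤f = *-nonneg (0≤f zero) (∏-nonneg (0≤f ∘ suc))

  *-mono-≤-nonneg : ∀ {a b c d} → 0ℤ ≤ a → 0ℤ ≤ d → a ≤ b → c ≤ d → a * c ≤ b * d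
  *-mono-≤-nonneg {a} {b} {c} {d} 0≤a 0≤d a≤b c≤d = ≤-trans (*-mono-≤ˡ 0≤a c≤d)
    (subst₂ _≤_ (*-comm d a) (*-comm d b) (*-mono-≤ˡ 0≤d a≤b))

  ∏-mono : ∀ {n} {f g : Fin n → ℤ} → (∀ i → 0ℤ ≤ f i) → (∀ i → f i ≤ g i) → ∏ f ≤ ∏ g
  ∏-mono {zero}  0≤f f≤g = ≤-refl
  ∏-mono {suc n} 0≤f f≤g = *-mono-≤-nonneg (0≤f zero) (∏-nonneg λ i → ≤-trans (0≤f (suc i)) (f≤g (suc i)))
    (f≤g zero) (∏-mono (0≤f ∘ suc) (f≤g ∘ suc))

  sum-const : ∀ n x → sum {n} (λ _ → x) ≡ ℤ.+ n * x
  sum-const zero    x = sum-empty _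
  sum-const (suc n) x = trans (sum-suc _) (trans (cong (λ t → x + t) (sum-const n x)) (lemma x (ℤ.+ n)))
    where
    lemma : ∀ x n → x + n * x ≡ (1ℤ + n) * x
    lemma = solve-∀

  per-replicate : ∀ n (u : Fin n → ℤ) → per (replicate n u) ≡ ℤ.+ (n !) * ∏ u
  per-replicate zero    u = refl
  per-replicate (suc n) u = begin
    (sum λ i → u i * per (map (_∘ punchIn i) (replicate n u)))
      ≡⟨ sum-cong (λ i → trans (cong (u i *_) (trans (cong per (map-replicate (_∘ punchIn i) n u)) (per-replicate n (u ∘ punchIn i))))
           (trans (lemma (u i) (ℤ.+ (n !)) _) (cong (ℤ.+ (n !) *_) (sym (∏-punchIn i u))))) ⟩
    sum {suc n} (λ _ → ℤ.+ (n !) * ∏ u)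
      ≡⟨ sum-const (suc n) _ ⟩
    ℤ.+ suc n * (ℤ.+ (n !) * ∏ u)
      ≡⟨ sym (*-assoc (ℤ.+ suc n) (ℤ.+ (n !)) (∏ u)) ⟩
    ℤ.+ suc n * ℤ.+ (n !) * ∏ u
      ≡⟨ cong (_* ∏ u) (sym (pos-* (suc n) (n !))) ⟩
    ℤ.+ (suc n !) * ∏ u ∎
    where
    open ≡-Reasoning
    lemma : ∀ a b c → a * (b * c) ≡ b * (a * c)
    lemma = solve-∀

  ^-nonneg : ∀ {x} n → 0ℤ ≤ x → 0ℤ ≤ x ^ n
  ^-nonneg zero    0≤x = +≤+ z≤n
  ^-nonneg (suc n) 0≤x = *-nonneg 0≤x (^-nonneg n 0≤x)

  ^-mono-≤ : ∀ {x y} n → 0ℤ ≤ x → x ≤ y → x ^ n ≤ y ^ n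
  ^-mono-≤ zero    0≤x x≤y = ≤-refl
  ^-mono-≤ (suc n) 0≤x x≤y = *-mono-≤-nonneg 0≤x (^-nonneg n (≤-trans 0≤x x≤y)) x≤y (^-mono-≤ n 0≤x x≤y)

  ^-cancel-≤ : ∀ {x y} n → 0ℤ ≤ y → x ^ suc n ≤ y ^ suc n → x ≤ y
  ^-cancel-≤ {x} {y} n 0≤y le with x ≤? y
  ... | yes x≤y = x≤y
  ... | no  x≰y = contradiction le (<⇒≱ (≤-<-trans (*-mono-≤ˡ 0≤y (^-mono-≤ n 0≤y (<⇒≤ y<x)))
                    (subst₂ _<_ (*-comm (x ^ n) y) (*-comm (x ^ n) x)
                      (*-monoˡ-<-pos (x ^ n) {{positive (^-pos n (≤-<-trans 0≤y y<x))}} y<x))))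
    where
    y<x : y < x
    y<x = ≰⇒> x≰y

  -- The graph of y^(r+1) lies above its tangent at A. Passing from r to r + 1 multiplies the defect
  -- by y and adds (1 + r) A^r (y - A)².
  tangent-power : ∀ r {A y} → 0ℤ ≤ A → 0ℤ ≤ y → (1ℤ + ℤ.+ r) * (A ^ r * y) ≤ y ^ suc r + ℤ.+ r * A ^ suc r
  tangent-power zero {A} {y} 0≤A 0≤y = ≤-reflexive (lemma A y)
    where
    lemma : ∀ A y → (1ℤ + 0ℤ) * (1ℤ * y) ≡ y * 1ℤ + 0ℤ * (A * 1ℤ)
    lemma = solve-∀
  tangent-power (suc r) {A} {y} 0≤A 0≤y = ≤-by
    (+-mono-≤ (*-nonneg 0≤y (diff (tangent-power r 0≤A 0≤y)))
      (*-nonneg {(1ℤ + ρ) * A ^ r} (*-nonneg {1ℤ + ρ} (+≤+ z≤n) (^-nonneg r 0≤A)) (square-nonneg (y - A))))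
    (lemma ρ A y (A ^ r) (y ^ r))
    where
    ρ = ℤ.+ r
    lemma : ∀ ρ A y B z → (y * (y * z) + (1ℤ + ρ) * (A * (A * B))) - (1ℤ + (1ℤ + ρ)) * (A * B * y) ≡
      y * ((y * z + ρ * (A * B)) - (1ℤ + ρ) * (B * y)) + (1ℤ + ρ) * B * ((y - A) * (y - A))
    lemma = solve-∀

  -- To be read with s the sum and π the product of R nonnegative numbers. Keeping just these three
  -- quantities lets the inequality grow by one number at a time, so that matrix entries can serve
  -- as multiplicities.
  record AMGM (s : ℤ) (R : ℕ) (π : ℤ) : Set where
    field
      s-nonneg : 0ℤ ≤ s
      bound    : π * (ℤ.+ R) ^ R ≤ s ^ R

  amgm-step : ∀ {s R π x} → 0ℤ ≤ x → AMGM s R π → AMGM (s + x) (suc R) (π * x)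
  amgm-step {s} {zero} {π} {x} 0≤x h = record
    { s-nonneg = +-mono-≤ s-nonneg 0≤x
    ; bound    = ≤-by (+-mono-≤ (*-nonneg 0≤x (diff bound)) s-nonneg) (lemma s π x)
    }
    where
    open AMGM h
    lemma : ∀ s π x → (s + x) * 1ℤ - π * x * 1ℤ ≡ x * (1ℤ - π * 1ℤ) + s
    lemma = solve-∀
  amgm-step {s} {R@(suc _)} {π} {x} 0≤x h = record
    { s-nonneg = +-mono-≤ s-nonneg 0≤x
    ; bound    = *-cancel-≤ (^-pos R 0<ρ) (≤-by (+-mono-≤ (*-nonneg (*-nonneg (^-nonneg (suc R) 0≤1+ρ) 0≤x) (diff bound)) (diff core))
        (lemma π x ((1ℤ + ρ) ^ suc R) (ρ ^ R) (s ^ R) ((s + x) ^ suc R)))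
    }
    where
    open AMGM h
    ρ = ℤ.+ R
    0<ρ : 0ℤ < ρ
    0<ρ = +<+ (s≤s z≤n)
    0≤1+ρ : 0ℤ ≤ 1ℤ + ρ
    0≤1+ρ = +≤+ z≤n
    -- The tangent is taken at the old mean s / ρ and evaluated at the new mean (s + x) / (1 + ρ),
    -- both multiplied by ρ (1 + ρ).
    core : s ^ R * ((1ℤ + ρ) ^ suc R * x) ≤ (s + x) ^ suc R * ρ ^ R
    core = *-cancel-≤ 0<ρ (≤-by (diff (tangent-power R {s * (1ℤ + ρ)} {(s + x) * ρ}
        (*-nonneg s-nonneg 0≤1+ρ) (*-nonneg (+-mono-≤ s-nonneg 0≤x) (<⇒≤ 0<ρ))))
      (sym (trans (cong₂ (λ A Y → ((s + x) * ρ * Y + ρ * (s * (1ℤ + ρ) * A)) - (1ℤ + ρ) * (A * ((s + x) * ρ)))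
             (^-*-distrib s (1ℤ + ρ) R) (^-*-distrib (s + x) ρ R))
        (lemma′ s x ρ (s ^ R) ((1ℤ + ρ) ^ R) ((s + x) ^ R) (ρ ^ R)))))
      where
      lemma′ : ∀ s x ρ S P X Q →
        ((s + x) * ρ * (X * Q) + ρ * (s * (1ℤ + ρ) * (S * P))) - (1ℤ + ρ) * (S * P * ((s + x) * ρ)) ≡
        ρ * ((s + x) * X * Q) - ρ * (S * ((1ℤ + ρ) * P * x))
      lemma′ = solve-∀
    lemma : ∀ π x P Q S X → Q * X - Q * (π * x * P) ≡ P * x * (S - π * Q) + (X * Q - S * (P * x))
    lemma = solve-∀

  amgm-repeat : ∀ {s R π x} w → 0ℤ ≤ x → AMGM s R π → AMGM (x * ℤ.+ w + s) (w ℕ.+ R) (x ^ w * π)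
  amgm-repeat {s} {R} {π} {x} zero 0≤x h = subst₂ (λ a b → AMGM a R b) (lemma s x) (sym (*-identityˡ π)) h
    where
    lemma : ∀ s x → s ≡ x * 0ℤ + s
    lemma = solve-∀
  amgm-repeat {s} {R} {π} {x} (suc w) 0≤x h = subst₂ (λ a b → AMGM a (suc (w ℕ.+ R)) b)
    (lemma s x (ℤ.+ w)) (lemma′ x (x ^ w) π) (amgm-step 0≤x (amgm-repeat w 0≤x h))
    where
    lemma : ∀ s x w → x * w + s + x ≡ x * (1ℤ + w) + s
    lemma = solve-∀
    lemma′ : ∀ x X π → X * π * x ≡ x * X * π
    lemma′ = solve-∀

  ι : ∀ {n} → (Fin n → ℕ) → Fin n → ℤ
  ι b i = ℤ.+ b i

  rowSum : ∀ {n} → List (Fin n → ℕ) → Fin n → ℕ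
  rowSum []       i = 0
  rowSum (b ∷ bs) i = b i ℕ.+ rowSum bs i

  monomial : ∀ {n} → List ℤ → List (Fin n → ℕ) → Fin n → ℤ
  monomial (x ∷ xs) (b ∷ bs) i = x ^ b i * monomial xs bs i
  monomial _        _        i = 1ℤ

  amgm : ∀ {n} xs (bs : List (Fin n → ℕ)) → length xs ≡ length bs → All (0ℤ <_) xs →
         ∀ i → AMGM (comb xs (map ι bs) i) (rowSum bs i) (monomial xs bs i)
  amgm []       []       len []       i = record { s-nonneg = ≤-refl ; bound = ≤-refl }
  amgm (x ∷ xs) (b ∷ bs) len (p ∷ ps) i = amgm-repeat (b i) (<⇒≤ p) (amgm xs bs (ℕ.suc-injective len) ps i)

  monomial-pos : ∀ {n} {xs} (bs : List (Fin n → ℕ)) → All (0ℤ <_) xs → ∀ i → 0ℤ < monomial xs bs i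
  monomial-pos []       []       i = +<+ (s≤s z≤n)
  monomial-pos (b ∷ bs) []       i = +<+ (s≤s z≤n)
  monomial-pos []       (p ∷ ps) i = +<+ (s≤s z≤n)
  monomial-pos (b ∷ bs) (p ∷ ps) i = *-pos (^-pos (b i) p) (monomial-pos bs ps i)

  ∏-monomial : ∀ {n R} xs (bs : List (Fin n → ℕ)) → length xs ≡ length bs → All (λ b → sumFin b ≡ R) bs →
               ∏ (monomial xs bs) ≡ prod xs ^ R
  ∏-monomial {n} {R} [] [] len [] = trans (∏-const n 1ℤ) (trans (^-zeroˡ n) (sym (^-zeroˡ R)))
  ∏-monomial {R = R} (x ∷ xs) (b ∷ bs) len (e ∷ es) = trans (∏-* (λ i → x ^ b i) (monomial xs bs)) (trans
    (cong₂ _*_ (trans (∏-^-sum x b) (cong (x ^_) e)) (∏-monomial xs bs (ℕ.suc-injective len) es))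
    (sym (^-*-distrib x (prod xs) R)))

  -- A lower bound R^n, with R = suc r, for the capacity of the product of the row forms. In each
  -- row, arithmetic-geometric means with the entries as multiplicities bounds the R-th power of the
  -- form; multiplied over all rows, the column sums give every variable the exponent R, and an R-th
  -- root remains to be taken.
  product-of-rows-bound : ∀ {n} r (bs : List (Fin n → ℕ)) →
    (∀ i → rowSum bs i ≡ suc r) → All (λ b → sumFin b ≡ suc r) bs →
    ∀ xs → length xs ≡ length bs → All (0ℤ <_) xs →
    (ℤ.+ suc r) ^ n * prod xs ≤ ∏ (comb xs (map ι bs))
  product-of-rows-bound {n} r bs rows cols xs len pxs = ^-cancel-≤ r
    (∏-nonneg λ i → AMGM.s-nonneg (amgm xs bs len pxs i))
    (subst₂ _≤_ left (∏-^ (comb xs (map ι bs)) (suc r))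
      (∏-mono (λ i → *-nonneg (<⇒≤ (monomial-pos bs pxs i)) (<⇒≤ (^-pos (suc r) 0<R)))
        λ i → subst (λ R → monomial xs bs i * (ℤ.+ R) ^ R ≤ comb xs (map ι bs) i ^ R) (rows i) (AMGM.bound (amgm xs bs len pxs i))))
    where
    0<R : 0ℤ < ℤ.+ suc r
    0<R = +<+ (s≤s z≤n)
    left : ∏ (λ i → monomial xs bs i * (ℤ.+ suc r) ^ suc r) ≡ ((ℤ.+ suc r) ^ n * prod xs) ^ suc r
    left = begin
      ∏ (λ i → monomial xs bs i * (ℤ.+ suc r) ^ suc r)          ≡⟨ ∏-* (monomial xs bs) _ ⟩
      ∏ (monomial xs bs) * ∏ {n} (λ _ → (ℤ.+ suc r) ^ suc r)    ≡⟨ cong₂ _*_ (∏-monomial xs bs len cols)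
                                                                     (trans (∏-^ {n} (λ _ → ℤ.+ suc r) (suc r)) (cong (_^ suc r) (∏-const n (ℤ.+ suc r)))) ⟩
      prod xs ^ suc r * ((ℤ.+ suc r) ^ n) ^ suc r               ≡⟨ *-comm (prod xs ^ suc r) _ ⟩
      ((ℤ.+ suc r) ^ n) ^ suc r * prod xs ^ suc r               ≡⟨ sym (^-*-distrib ((ℤ.+ suc r) ^ n) (prod xs) (suc r)) ⟩
      ((ℤ.+ suc r) ^ n * prod xs) ^ suc r ∎
      where open ≡-Reasoning

  -- With n equal columns u the permanent is n! ∏ u, whose capacity is bounded by
  -- `product-of-rows-bound`; `capacity-bound` with no fixed columns then passes to the mixed
  -- permanent.
  van-der-Waerden-pos : ∀ {n} r (bs : List (Fin n → ℕ)) → length bs ≡ n → All (λ b → ∀ i → 0 ℕ.< b i) bs →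
    (∀ i → rowSum bs i ≡ suc r) → All (λ b → sumFin b ≡ suc r) bs →
    (ℤ.+ suc r) ^ n * ℤ.+ (n !) ≤ (ℤ.+ n) ^ n * per (map ι bs)
  van-der-Waerden-pos {zero} r [] len pos rows cols = ≤-refl
  van-der-Waerden-pos {n@(suc _)} r bs@(b ∷ bs′) len pos rows cols =
    subst ((ℤ.+ suc r) ^ n * ℤ.+ (n !) ≤_) (trans (*-identityˡ _)
        (cong₂ (λ k cs → (ℤ.+ k) ^ k * per cs) len′ (++-identityʳ (map ι bs))))
      (capacity-bound (ι b) (map ι bs′) [] (trans (ℕ.+-identityʳ _) len′) (All.map⁺ (All.map (λ p i → +<+ (p i)) pos)) []
        ((ℤ.+ suc r) ^ n * ℤ.+ (n !)) 1ℤ (+≤+ z≤n) hyp)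
    where
    len′ : length (map ι bs) ≡ n
    len′ = trans (length-map ι bs) len
    lemma : ∀ a b c → a * b * c ≡ b * (a * c)
    lemma = solve-∀
    hyp : ∀ xs → length xs ≡ length (map ι bs) → All (0ℤ <_) xs →
      (ℤ.+ suc r) ^ n * ℤ.+ (n !) * prod xs ≤ 1ℤ * per (replicate (length (map ι bs)) (comb xs (map ι bs)) ++ [])
    hyp xs lxs pxs = subst₂ _≤_ (sym (lemma ((ℤ.+ suc r) ^ n) (ℤ.+ (n !)) (prod xs)))
      (sym (trans (*-identityˡ _) (trans (cong per (trans (++-identityʳ _) (cong (λ k → replicate k (comb xs (map ι bs))) len′)))
        (per-replicate n (comb xs (map ι bs))))))
      (*-mono-≤ˡ {ℤ.+ (n !)} (+≤+ z≤n) (product-of-rows-bound r bs rows cols xs (trans lxs (length-map ι bs)) pxs))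

  -- From positive to nonnegative matrices

  NonNeg : ∀ {n} → (Fin n → ℤ) → Set
  NonNeg c = ∀ i → 0ℤ ≤ c i

  NonNeg-restrict : ∀ {k n} (ρ : Fin k → Fin n) {cs : List (Fin n → ℤ)} → All NonNeg cs → All NonNeg (map (_∘ ρ) cs)
  NonNeg-restrict ρ p = All.map⁺ (All.map (_∘ ρ) p)

  per-nonneg : ∀ {n} {cs : List (Fin n → ℤ)} → All NonNeg cs → 0ℤ ≤ per cs
  per-nonneg {zero}  []       = +≤+ z≤n
  per-nonneg {zero}  (p ∷ ps) = ≤-refl
  per-nonneg {suc n} []       = ≤-refl
  per-nonneg {suc n} (p ∷ ps) = sum-nonneg λ i → *-nonneg (p i) (per-nonneg (NonNeg-restrict (punchIn i) ps))

  perturb : ∀ {n} → ℤ → (Fin n → ℤ) → Fin n → ℤ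
  perturb M c i = M * c i + 1ℤ

  -- As a polynomial in M, the permanent of M c + 1 has `per cs` as coefficient of M^n, and for M ≥
  -- 1 the lower terms are at most B M^(n-1) with B independent of M. The extra factor M on both
  -- sides avoids the exponent n - 1.
  perturb-bound : ∀ {n} (cs : List (Fin n → ℤ)) → All NonNeg cs →
    ∃ λ B → 0ℤ ≤ B × (∀ M → 1ℤ ≤ M → M * per (map (perturb M) cs) ≤ M ^ n * (M * per cs + B))
  perturb-bound {zero}  []       ps = 0ℤ , ≤-refl , λ M _ → ≤-reflexive (lemma M)
    where
    lemma : ∀ M → M * 1ℤ ≡ 1ℤ * (M * 1ℤ + 0ℤ)
    lemma = solve-∀
  perturb-bound {zero}  (_ ∷ _)  ps = 0ℤ , ≤-refl , λ M _ → ≤-reflexive (lemma M)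
    where
    lemma : ∀ M → M * 0ℤ ≡ 1ℤ * (M * 0ℤ + 0ℤ)
    lemma = solve-∀
  perturb-bound {suc n} []       ps = 0ℤ , ≤-refl , λ M _ → ≤-reflexive (lemma M (M ^ suc n))
    where
    lemma : ∀ M X → M * 0ℤ ≡ X * (M * 0ℤ + 0ℤ)
    lemma = solve-∀
  perturb-bound {suc n} (c ∷ cs) (p ∷ ps) = sum b , sum-nonneg b-nonneg , main
    where
    minor : Fin (suc n) → List (Fin n → ℤ)
    minor i = map (_∘ punchIn i) cs
    ih : ∀ i → _
    ih i = perturb-bound (minor i) (NonNeg-restrict (punchIn i) ps)
    D B b : Fin (suc n) → ℤ
    D i = per (minor i)
    B i = proj₁ (ih i)
    b i = c i * B i + D i + B i
    B-nonneg : ∀ i → 0ℤ ≤ B i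
    B-nonneg i = proj₁ (proj₂ (ih i))
    b-nonneg : ∀ i → 0ℤ ≤ b i
    b-nonneg i = +-mono-≤ (+-mono-≤ (*-nonneg (p i) (B-nonneg i))
      (per-nonneg (NonNeg-restrict (punchIn i) ps))) (B-nonneg i)
    main : ∀ M → 1ℤ ≤ M → M * per (map (perturb M) (c ∷ cs)) ≤ M ^ suc n * (M * per (c ∷ cs) + sum b)
    main M 1≤M = subst₂ _≤_ (sym (*-sumˡ M _)) right (sum-mono term)
      where
      0≤M : 0ℤ ≤ M
      0≤M = ≤-trans (+≤+ z≤n) 1≤M
      X = M ^ n
      right : sum (λ i → M * X * (M * (c i * D i) + b i)) ≡ M * X * (M * per (c ∷ cs) + sum b)
      right = trans (sym (*-sumˡ (M * X) _)) (cong (M * X *_)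
        (trans (sum-+ (λ i → M * (c i * D i)) b) (cong (_+ sum b) (sym (*-sumˡ M λ i → c i * D i)))))
      lemma : ∀ M X c D B D′ →
        M * X * (M * (c * D) + (c * B + D + B)) - M * ((M * c + 1ℤ) * D′) ≡
        (M * c + 1ℤ) * (X * (M * D + B) - M * D′) + X * B * (M - 1ℤ)
      lemma = solve-∀
      term : ∀ i → M * (perturb M c i * per (map (_∘ punchIn i) (map (perturb M) cs))) ≤ M * X * (M * (c i * D i) + b i)
      term i = ≤-by (+-mono-≤
          (*-nonneg (+-mono-≤ (*-nonneg 0≤M (p i)) (+≤+ z≤n)) (diff bound))
          (*-nonneg (*-nonneg (^-nonneg n 0≤M) (B-nonneg i)) (diff 1≤M)))
        (lemma M X (c i) (D i) (B i) _)
        where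
        bound : M * per (map (_∘ punchIn i) (map (perturb M) cs)) ≤ X * (M * D i + B i)
        bound = subst (λ cs′ → M * per cs′ ≤ X * (M * D i + B i)) commute (proj₂ (proj₂ (ih i)) M 1≤M)
          where
          commute : map (perturb M) (map (_∘ punchIn i) cs) ≡ map (_∘ punchIn i) (map (perturb M) cs)
          commute = trans (sym (map-∘ cs)) (map-∘ cs)

  perturbℕ : ∀ {n} → ℕ → (Fin n → ℕ) → Fin n → ℕ
  perturbℕ M b i = M ℕ.* b i ℕ.+ 1

  rowSum-perturb : ∀ {n} M (bs : List (Fin n → ℕ)) i → rowSum (map (perturbℕ M) bs) i ≡ M ℕ.* rowSum bs i ℕ.+ length bs
  rowSum-perturb M []       i = sym (trans (ℕ.+-identityʳ _) (ℕ.*-zeroʳ M))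
  rowSum-perturb M (b ∷ bs) i = trans (cong (M ℕ.* b i ℕ.+ 1 ℕ.+_) (rowSum-perturb M bs i)) (lemma M (b i) (rowSum bs i) (length bs))
    where
    lemma : ∀ M b r l → M ℕ.* b ℕ.+ 1 ℕ.+ (M ℕ.* r ℕ.+ l) ≡ M ℕ.* (b ℕ.+ r) ℕ.+ (1 ℕ.+ l)
    lemma = ℕ-Solver.solve-∀

  sumFin-perturb : ∀ {n} M (b : Fin n → ℕ) → sumFin (perturbℕ M b) ≡ M ℕ.* sumFin b ℕ.+ n
  sumFin-perturb {zero}  M b = sym (trans (ℕ.+-identityʳ _) (ℕ.*-zeroʳ M))
  sumFin-perturb {suc n} M b = trans (cong (M ℕ.* b zero ℕ.+ 1 ℕ.+_) (sumFin-perturb M (b ∘ suc))) (lemma M (b zero) (sumFin (b ∘ suc)) n)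
    where
    lemma : ∀ M b r l → M ℕ.* b ℕ.+ 1 ℕ.+ (M ℕ.* r ℕ.+ l) ≡ M ℕ.* (b ℕ.+ r) ℕ.+ (1 ℕ.+ l)
    lemma = ℕ-Solver.solve-∀

  -- The positive case applied to M b + 1 for large M.
  van-der-Waerden : ∀ {n} R (bs : List (Fin n → ℕ)) → length bs ≡ n →
    (∀ i → rowSum bs i ≡ R) → All (λ b → sumFin b ≡ R) bs →
    (ℤ.+ R) ^ n * ℤ.+ (n !) ≤ (ℤ.+ n) ^ n * per (map ι bs)
  van-der-Waerden {zero} R [] len rows cols = ≤-refl
  van-der-Waerden {n@(suc n′)} R bs len rows cols with (ℤ.+ R) ^ n * ℤ.+ (n !) ≤? (ℤ.+ n) ^ n * per (map ι bs)
  ... | yes le = le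
  ... | no  ≰  = contradiction absurd (<⇒≱ (+<+ {0} {1} (s≤s z≤n)))
    where
    X V D B : ℤ
    X = (ℤ.+ R) ^ n * ℤ.+ (n !)
    V = (ℤ.+ n) ^ n
    D = per (map ι bs)
    nonneg : All NonNeg (map ι bs)
    nonneg = All.map⁺ (All.universal (λ b i → +≤+ z≤n) bs)
    B = proj₁ (perturb-bound (map ι bs) nonneg)
    0≤V : 0ℤ ≤ V
    0≤V = ^-nonneg {ℤ.+ n} n (+≤+ z≤n)
    0≤B : 0ℤ ≤ B
    0≤B = proj₁ (proj₂ (perturb-bound (map ι bs) nonneg))
    -- If the inequality fails, then X ≥ V D + 1 by integrality, while the perturbed case yields M X
    -- ≤ V (M D + B). Together they give M ≤ V B, which M = 1 + V B contradicts.
    m : ℕ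
    m = suc ℤ.∣ V * B ∣
    M : ℤ
    M = ℤ.+ m
    M≡ : M ≡ 1ℤ + V * B
    M≡ = cong (λ t → 1ℤ + t) (0≤i⇒+∣i∣≡i (*-nonneg 0≤V 0≤B))
    0<M : 0ℤ < M
    0<M = +<+ (s≤s z≤n)
    D′ = per (map (perturb M) (map ι bs))
    upper : M * D′ ≤ M ^ n * (M * D + B)
    upper = proj₂ (proj₂ (perturb-bound (map ι bs) nonneg)) M (+≤+ (s≤s z≤n))
    r : ℕ
    r = m ℕ.* R ℕ.+ n′
    ι-perturb : ∀ b i → ι (perturbℕ m b) i ≡ perturb M (ι b) i
    ι-perturb b i = cong (_+ 1ℤ) (pos-* m (b i))
    per-cong : ∀ {k} (cs : List (Fin n → ℕ)) (ρ : Fin k → Fin n) →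
      per (map (_∘ ρ) (map ι (map (perturbℕ m) cs))) ≡ per (map (_∘ ρ) (map (perturb M) (map ι cs)))
    per-cong {zero}  []       ρ = refl
    per-cong {zero}  (c ∷ cs) ρ = refl
    per-cong {suc k} []       ρ = refl
    per-cong {suc k} (c ∷ cs) ρ = sum-cong λ i → cong₂ _*_ (ι-perturb c (ρ i))
      (trans (cong per (map-restrict-∘ ρ (punchIn i) _)) (trans (per-cong cs (ρ ∘ punchIn i))
        (cong per (sym (map-restrict-∘ ρ (punchIn i) _)))))
    D′≡ : per (map ι (map (perturbℕ m) bs)) ≡ D′
    D′≡ = trans (cong per (sym (map-id (map ι (map (perturbℕ m) bs)))))
      (trans (per-cong bs id) (cong per (map-id (map (perturb M) (map ι bs)))))
    positive-case : (ℤ.+ suc r) ^ n * ℤ.+ (n !) ≤ V * D′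
    positive-case = subst (λ t → (ℤ.+ suc r) ^ n * ℤ.+ (n !) ≤ V * t) D′≡
      (van-der-Waerden-pos r (map (perturbℕ m) bs) (trans (length-map _ bs) len)
        (All.map⁺ (All.universal (λ b i → subst (0 ℕ.<_) (ℕ.+-comm 1 _) (s≤s z≤n)) bs))
        (λ i → trans (rowSum-perturb m bs i) (trans (cong₂ (λ s t → m ℕ.* s ℕ.+ t) (rows i) len) (ℕ.+-suc (m ℕ.* R) n′)))
        (All.map⁺ (All.map (λ {b} e → trans (sumFin-perturb m b) (trans (cong (λ s → m ℕ.* s ℕ.+ n) e) (ℕ.+-suc (m ℕ.* R) n′))) cols)))
    M^nX : M ^ n * X ≤ V * D′
    M^nX = ≤-trans (subst₂ _≤_ (trans (cong (_* ℤ.+ (n !)) (^-*-distrib M (ℤ.+ R) n)) (*-assoc (M ^ n) _ _)) refl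
        (subst₂ _≤_ (*-comm (ℤ.+ (n !)) _) (*-comm (ℤ.+ (n !)) _) (*-mono-≤ˡ {ℤ.+ (n !)} (+≤+ z≤n)
          (^-mono-≤ n (*-nonneg {M} {ℤ.+ R} (+≤+ z≤n) (+≤+ z≤n)) base))))
      positive-case
      where
      base : M * ℤ.+ R ≤ ℤ.+ suc r
      base = subst (_≤ ℤ.+ suc r) (pos-* m R) (+≤+ (ℕ.≤-trans (ℕ.m≤m+n (m ℕ.* R) n′) (ℕ.n≤1+n r)))
    MX : M * X ≤ V * (M * D + B)
    MX = *-cancel-≤ (^-pos {M} n 0<M) (≤-by
      (+-mono-≤ (*-nonneg (<⇒≤ 0<M) (diff M^nX)) (*-nonneg 0≤V (diff upper)))
      (lemma (M ^ n) M X V D D′ B))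
      where
      lemma : ∀ P M X V D D′ B → P * (V * (M * D + B)) - P * (M * X) ≡ M * (V * D′ - P * X) + V * (P * (M * D + B) - M * D′)
      lemma = solve-∀
    gap : 1ℤ + V * D ≤ X
    gap = i<j⇒suc[i]≤j (≰⇒> ≰)
    absurd : 1ℤ ≤ 0ℤ
    absurd = ≤-by (+-mono-≤ (diff MX) (*-nonneg (<⇒≤ 0<M) (diff gap)))
      (trans (lemma V D B X) (cong (λ M → (V * (M * D + B) - M * X) + M * (X - (1ℤ + V * D))) (sym M≡)))
      where
      lemma : ∀ V D B X → 0ℤ - 1ℤ ≡
        (V * ((1ℤ + V * B) * D + B) - (1ℤ + V * B) * X) + (1ℤ + V * B) * (X - (1ℤ + V * D))
      lemma = solve-∀

open Integers using (per; sum; sum-cong; sum-suc; sum-empty; ι; rowSum; van-der-Waerden)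
open import Data.Nat using (_+_; _*_; _∸_; _^_; _≤_)
open import Data.Nat.DivMod using (_%_; _/_; _mod_; %-distribˡ-+; m<n⇒m%n≡m; [m+n]%n≡m%n; m≡m%n+[m/n]*n; m%n<n)
open import Data.Nat.Properties hiding (_≟_)
open import Data.Nat.Tactic.RingSolver using (solve-∀)

-- Counting

bit : Bool → ℕ
bit b = if b then 1 else 0

⌊⌋-true : ∀ {P : Set} {p? : Dec P} → ⌊ p? ⌋ ≡ true → P
⌊⌋-true {p? = yes p} eq = p

true-⌊⌋ : ∀ {P : Set} {p? : Dec P} → P → ⌊ p? ⌋ ≡ true
true-⌊⌋ {p? = yes _} p = refl
true-⌊⌋ {p? = no ¬p} p = contradiction p ¬p

sumFin-cong : ∀ {n} {f g : Fin n → ℕ} → f ≗ g → sumFin f ≡ sumFin g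
sumFin-cong {zero}  f≗g = refl
sumFin-cong {suc n} f≗g = cong₂ _+_ (f≗g zero) (sumFin-cong (f≗g ∘ suc))

sumFin-+ : ∀ {n} (f g : Fin n → ℕ) → sumFin (λ i → f i + g i) ≡ sumFin f + sumFin g
sumFin-+ {zero}  f g = refl
sumFin-+ {suc n} f g = trans (cong (f zero + g zero +_) (sumFin-+ (f ∘ suc) (g ∘ suc)))
  (lemma (f zero) (g zero) (sumFin (f ∘ suc)) (sumFin (g ∘ suc)))
  where
  lemma : ∀ a b c d → a + b + (c + d) ≡ a + c + (b + d)
  lemma = solve-∀

sumFin-*ˡ : ∀ {n} c (f : Fin n → ℕ) → sumFin (λ i → c * f i) ≡ c * sumFin f
sumFin-*ˡ {zero}  c f = sym (*-zeroʳ c)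
sumFin-*ˡ {suc n} c f = trans (cong (c * f zero +_) (sumFin-*ˡ c (f ∘ suc))) (sym (*-distribˡ-+ c (f zero) _))

sumFin-const : ∀ n c → sumFin {n} (λ _ → c) ≡ n * c
sumFin-const zero    c = refl
sumFin-const (suc n) c = cong (c +_) (sumFin-const n c)

sumFin-comm : ∀ {m n} (f : Fin m → Fin n → ℕ) →
              sumFin (λ i → sumFin (λ j → f i j)) ≡ sumFin (λ j → sumFin (λ i → f i j))
sumFin-comm {zero}  {n} f = sym (trans (sumFin-const n 0) (*-zeroʳ n))
sumFin-comm {suc m} {n} f = trans (cong (sumFin (f zero) +_) (sumFin-comm (f ∘ suc)))
  (sym (sumFin-+ (f zero) (λ j → sumFin (λ i → f (suc i) j))))

sumFin-mono : ∀ {n} {f g : Fin n → ℕ} → (∀ i → f i ≤ g i) → sumFin f ≤ sumFin g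
sumFin-mono {zero}  f≤g = z≤n
sumFin-mono {suc n} f≤g = +-mono-≤ (f≤g zero) (sumFin-mono (f≤g ∘ suc))

sumFin-full : ∀ {n} (f : Fin n → ℕ) → (∀ i → f i ≤ 1) → sumFin f ≡ n → ∀ i → f i ≡ 1
sumFin-full {suc n} f f≤1 Σf≡n = λ
    { zero    → f₀≡1
    ; (suc i) → sumFin-full (f ∘ suc) (f≤1 ∘ suc) (suc-injective (trans (cong (_+ sumFin (f ∘ suc)) (sym f₀≡1)) Σf≡n)) i
    }
  where
  rest≤n : sumFin (f ∘ suc) ≤ n
  rest≤n = ≤-trans (sumFin-mono (f≤1 ∘ suc)) (≤-reflexive (trans (sumFin-const n 1) (*-identityʳ n)))
  f₀≡1 : f zero ≡ 1
  f₀≡1 = ≤-antisym (f≤1 zero)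
    (+-cancelʳ-≤ n 1 (f zero) (≤-trans (≤-reflexive (sym Σf≡n)) (+-monoʳ-≤ (f zero) rest≤n)))

count-sumFin : ∀ {n} (p : Fin n → Bool) → count p ≡ sumFin (bit ∘ p)
count-sumFin {zero}  p = refl
count-sumFin {suc n} p = cong (bit (p zero) +_) (count-sumFin (p ∘ suc))

count-none : ∀ {n} {p : Fin n → Bool} → (∀ i → p i ≡ false) → count p ≡ 0
count-none {zero}  none = refl
count-none {suc n} none = cong₂ _+_ (cong bit (none zero)) (count-none (none ∘ suc))

count-unique : ∀ {n} {p : Fin n → Bool} i → p i ≡ true → (∀ j → p j ≡ true → j ≡ i) → count p ≡ 1
count-unique {p = p} zero pi uniq = cong₂ _+_ (cong bit pi) (count-none none)
  where
  none : ∀ j → p (suc j) ≡ false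
  none j with p (suc j) in eq
  ... | false = refl
  ... | true with () ← uniq (suc j) eq
count-unique {p = p} (suc i) pi uniq = cong₂ _+_ (cong bit p₀) (count-unique i pi λ j pj → Fin.suc-injective (uniq (suc j) pj))
  where
  p₀ : p zero ≡ false
  p₀ with p zero in eq
  ... | false = refl
  ... | true with () ← uniq zero eq

count-pos : ∀ {n} {p : Fin n → Bool} i → p i ≡ true → 1 ≤ count p
count-pos zero    pi rewrite pi = s≤s z≤n
count-pos {p = p} (suc i) pi = ≤-trans (count-pos i pi) (m≤n+m _ (bit (p zero)))

count≤1⇒unique : ∀ {n} {p : Fin n → Bool} → count p ≤ 1 → ∀ {i j} → p i ≡ true → p j ≡ true → i ≡ j
count≤1⇒unique le {zero}  {zero}  pi pj = refl
count≤1⇒unique le {zero}  {suc j} pi pj rewrite pi =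
  contradiction (≤-trans (s≤s (count-pos j pj)) le) λ { (s≤s ()) }
count≤1⇒unique le {suc i} {zero}  pi pj rewrite pj =
  contradiction (≤-trans (s≤s (count-pos i pi)) le) λ { (s≤s ()) }
count≤1⇒unique {p = p} le {suc i} {suc j} pi pj =
  cong suc (count≤1⇒unique (≤-trans (m≤n+m _ (bit (p zero))) le) pi pj)

count-at-most-one : ∀ {n} {p : Fin n → Bool} → (∀ {i j} → p i ≡ true → p j ≡ true → i ≡ j) → count p ≤ 1
count-at-most-one {zero}  uniq = z≤n
count-at-most-one {suc n} {p} uniq with p zero in p₀
... | false = count-at-most-one λ pi pj → Fin.suc-injective (uniq pi pj)
... | true  = ≤-reflexive (cong suc (count-none none))
  where
  none : ∀ j → p (suc j) ≡ false
  none j with p (suc j) in eq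
  ... | false = refl
  ... | true with () ← uniq p₀ eq

count-≟ : ∀ {n} (x : Fin n) → count (λ s → ⌊ x ≟ s ⌋) ≡ 1
count-≟ x = count-unique x (true-⌊⌋ {p? = x ≟ x} refl) λ j eq → sym (⌊⌋-true {p? = x ≟ j} eq)

sumFin-fibres : ∀ {k n} (f : Fin k → Fin n) → sumFin (λ s → count (λ i → ⌊ f i ≟ s ⌋)) ≡ k
sumFin-fibres {k} {n} f = begin
  sumFin (λ s → count (λ i → ⌊ f i ≟ s ⌋))                ≡⟨ sumFin-cong (λ s → count-sumFin λ i → ⌊ f i ≟ s ⌋) ⟩
  sumFin (λ s → sumFin (λ i → bit ⌊ f i ≟ s ⌋))           ≡⟨ sumFin-comm (λ s i → bit ⌊ f i ≟ s ⌋) ⟩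
  sumFin (λ i → sumFin (λ s → bit ⌊ f i ≟ s ⌋))           ≡⟨ sumFin-cong (λ i → trans (sym (count-sumFin λ s → ⌊ f i ≟ s ⌋)) (count-≟ (f i))) ⟩
  sumFin {k} (λ _ → 1)                                    ≡⟨ trans (sumFin-const k 1) (*-identityʳ k) ⟩
  k                                                       ∎
  where open ≡-Reasoning

-- Each fibre has at most one element and the n fibres together have n. This converts injectivity of
-- rows and columns into the counting form of `IsLatin`.
injective⇒fibres≡1 : ∀ {n} (f : Fin n → Fin n) → (∀ {i j} → f i ≡ f j → i ≡ j) →
                     ∀ s → count (λ i → ⌊ f i ≟ s ⌋) ≡ 1
injective⇒fibres≡1 f f-inj = sumFin-full _
  (λ s → count-at-most-one λ {i} {j} fi fj → f-inj (trans (⌊⌋-true {p? = f i ≟ s} fi) (sym (⌊⌋-true {p? = f j ≟ s} fj))))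
  (sumFin-fibres f)

-- Latin rectangles

extend : ∀ {n} → Fin (suc n) → (Fin n → Fin n) → Fin (suc n) → Fin (suc n)
extend i σ zero    = i
extend i σ (suc j) = punchIn i (σ j)

minor : ∀ {n} → (Fin (suc n) → Fin (suc n) → Bool) → Fin (suc n) → Fin n → Fin n → Bool
minor A i j r = A (suc j) (punchIn i r)

-- The recursion copies the expansion of the permanent along its first column, so the length of the
-- list is a permanent term by term.
matchings : ∀ {n} → (Fin n → Fin n → Bool) → List (Fin n → Fin n)
matchings {zero}  A = [ (λ ()) ]
matchings {suc n} A = concat (tabulate λ i → if A zero i then map (extend i) (matchings (minor A i)) else [])

IsMatching : ∀ {n} → (Fin n → Fin n → Bool) → (Fin n → Fin n) → Set
IsMatching A σ = (∀ j → A j (σ j) ≡ true) × (∀ {i j} → σ i ≡ σ j → i ≡ j)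

Differ : ∀ {k n} → (Fin k → Fin n) → (Fin k → Fin n) → Set
Differ σ τ = ∃ λ j → σ j ≢ τ j

matchings-sound : ∀ {n} (A : Fin n → Fin n → Bool) → All (IsMatching A) (matchings A)
matchings-sound {zero}  A = ((λ ()) , λ { {()} }) ∷ []
matchings-sound {suc n} A = All.concat⁺ (All.tabulate⁺ each)
  where
  each : ∀ i → All (IsMatching A) (if A zero i then map (extend i) (matchings (minor A i)) else [])
  each i with A zero i in A₀i
  ... | false = []
  ... | true  = All.map⁺ (All.map extended (matchings-sound (minor A i)))
    where
    extended : ∀ {σ} → IsMatching (minor A i) σ → IsMatching A (extend i σ)
    extended {σ} (avail , inj) = (λ { zero → A₀i ; (suc j) → avail j }) , λ
      { {zero}  {zero}  eq → refl
      ; {zero}  {suc j} eq → contradiction (sym eq) (punchInᵢ≢i i (σ j))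
      ; {suc j} {zero}  eq → contradiction eq (punchInᵢ≢i i (σ j))
      ; {suc j} {suc k} eq → cong suc (inj (punchIn-injective i (σ j) (σ k) eq))
      }

matchings-distinct : ∀ {n} (A : Fin n → Fin n → Bool) → AllPairs Differ (matchings A)
matchings-distinct {zero}  A = [] ∷ []
matchings-distinct {suc n} A = AllPairs.concat⁺ (All.tabulate⁺ within) (AllPairs.tabulate⁺ across)
  where
  branch : Fin (suc n) → List (Fin (suc n) → Fin (suc n))
  branch i = if A zero i then map (extend i) (matchings (minor A i)) else []
  within : ∀ i → AllPairs Differ (branch i)
  within i with A zero i
  ... | false = []
  ... | true  = AllPairs.map⁺ (AllPairs.map (λ { (j , σj≢τj) → suc j , σj≢τj ∘ punchIn-injective i _ _ })
                  (matchings-distinct (minor A i)))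
  first : ∀ i → All (λ σ → σ zero ≡ i) (branch i)
  first i with A zero i
  ... | false = []
  ... | true  = All.map⁺ (All.universal (λ σ → refl) _)
  across : ∀ {i j} → i ≢ j → All (λ σ → All (Differ σ) (branch j)) (branch i)
  across {i} {j} i≢j = All.map (λ σ₀≡i → All.map (λ τ₀≡j → zero , λ σ₀≡τ₀ → i≢j (trans (sym σ₀≡i) (trans σ₀≡τ₀ τ₀≡j)))
    (first j)) (first i)

columns : ∀ {k n} → (Fin k → Fin n → Bool) → List (Fin n → ℕ)
columns A = tabulate λ j r → bit (A j r)

length-concat-tabulate : ∀ {n} {X : Set} (f : Fin n → List X) → ℤ.+ length (concat (tabulate f)) ≡ sum (λ i → ℤ.+ length (f i))
length-concat-tabulate {zero}  f = sym (sum-empty _)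
length-concat-tabulate {suc n} f = trans (cong ℤ.+_ (length-++ (f zero)))
  (trans (cong (ℤ._+_ (ℤ.+ length (f zero))) (length-concat-tabulate (f ∘ suc))) (sym (sum-suc λ i → ℤ.+ length (f i))))

length-matchings : ∀ {n} (A : Fin n → Fin n → Bool) → ℤ.+ length (matchings A) ≡ per (map ι (columns A))
length-matchings {zero}  A = refl
length-matchings {suc n} A = trans
  (length-concat-tabulate λ i → if A zero i then map (extend i) (matchings (minor A i)) else []) (sum-cong each)
  where
  minor-columns : ∀ i → map ι (columns (minor A i)) ≡ map (_∘ punchIn i) (map ι (columns (A ∘ suc)))
  minor-columns i = trans (map-tabulate _ ι) (sym (trans (cong (map (_∘ punchIn i)) (map-tabulate _ ι)) (map-tabulate _ (_∘ punchIn i))))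
  each : ∀ i → ℤ.+ length (if A zero i then map (extend i) (matchings (minor A i)) else []) ≡
    (ℤ.+ bit (A zero i)) ℤ.* per (map (_∘ punchIn i) (map ι (columns (A ∘ suc))))
  each i with A zero i
  ... | false = refl
  ... | true  = trans (cong ℤ.+_ (length-map (extend i) (matchings (minor A i)))) (trans (length-matchings (minor A i))
    (trans (cong per (minor-columns i)) (sym (ℤ.*-identityˡ _))))

pos-^ : ∀ a n → ℤ.+ (a ^ n) ≡ (ℤ.+ a) ℤ.^ n
pos-^ a zero    = refl
pos-^ a (suc n) = trans (ℤ.pos-* a (a ^ n)) (cong (ℤ._*_ (ℤ.+ a)) (pos-^ a n))

matchings-bound : ∀ {n} R (A : Fin n → Fin n → Bool) →
  (∀ s → sumFin (λ j → bit (A j s)) ≡ R) → (∀ j → sumFin (λ s → bit (A j s)) ≡ R) →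
  R ^ n * n ! ≤ n ^ n * length (matchings A)
matchings-bound {n} R A rows cols = ℤ.drop‿+≤+ (subst₂ ℤ._≤_
  (sym (trans (ℤ.pos-* (R ^ n) (n !)) (cong (ℤ._* ℤ.+ (n !)) (pos-^ R n))))
  (sym (trans (ℤ.pos-* (n ^ n) _) (cong₂ ℤ._*_ (pos-^ n n) (length-matchings A))))
  (van-der-Waerden R (columns A) (length-tabulate _) (λ i → trans (rowSum-tabulate (λ j r → bit (A j r)) i) (rows i)) (All.tabulate⁺ cols)))
  where
  rowSum-tabulate : ∀ {k n} (g : Fin k → Fin n → ℕ) i → rowSum (tabulate g) i ≡ sumFin (λ j → g j i)
  rowSum-tabulate {zero}  g i = refl
  rowSum-tabulate {suc k} g i = cong (g zero i +_) (rowSum-tabulate (g ∘ suc) i)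

Rectangle : ℕ → ℕ → Set
Rectangle k m = Fin k → Fin m → Fin m

used : ∀ {k m} → Rectangle k m → Fin m → Fin m → ℕ
used R j s = count (λ i → ⌊ R i j ≟ s ⌋)

isZero : ℕ → Bool
isZero zero    = true
isZero (suc _) = false

available : ∀ {k m} → Rectangle k m → Fin m → Fin m → Bool
available R j s = isZero (used R j s)

record IsLatinRectangle {k m} (R : Rectangle k m) : Set where
  field
    rows-once    : ∀ i s → count (λ j → ⌊ R i j ≟ s ⌋) ≡ 1
    columns-once : ∀ j s → used R j s ≤ 1

  bit-available : ∀ j s → used R j s + bit (available R j s) ≡ 1
  bit-available j s with used R j s | columns-once j s
  ... | zero        | _ = refl
  ... | suc zero    | _ = refl
  ... | suc (suc _) | s≤s ()

  -- The k cells of a column use k different symbols. Together with `available-symbol` this makes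
  -- the graph of columns and admissible symbols regular of degree m - k, as the van der Waerden
  -- inequality demands.
  available-column : ∀ j → k + sumFin (λ s → bit (available R j s)) ≡ m
  available-column j = begin
    k + sumFin (λ s → bit (available R j s))
      ≡⟨ cong (_+ sumFin (λ s → bit (available R j s))) (sym (sumFin-fibres (λ i → R i j))) ⟩
    sumFin (used R j) + sumFin (λ s → bit (available R j s))
      ≡⟨ sym (sumFin-+ (used R j) _) ⟩
    sumFin (λ s → used R j s + bit (available R j s))
      ≡⟨ sumFin-cong (bit-available j) ⟩
    sumFin {m} (λ _ → 1)
      ≡⟨ trans (sumFin-const m 1) (*-identityʳ m) ⟩
    m ∎
    where open ≡-Reasoning

  used-symbol : ∀ s → sumFin (λ j → used R j s) ≡ k
  used-symbol s = begin
    sumFin (λ j → used R j s)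
      ≡⟨ sumFin-cong (λ j → count-sumFin λ i → ⌊ R i j ≟ s ⌋) ⟩
    sumFin (λ j → sumFin (λ i → bit ⌊ R i j ≟ s ⌋))
      ≡⟨ sumFin-comm (λ j i → bit ⌊ R i j ≟ s ⌋) ⟩
    sumFin (λ i → sumFin (λ j → bit ⌊ R i j ≟ s ⌋))
      ≡⟨ sumFin-cong (λ i → trans (sym (count-sumFin λ j → ⌊ R i j ≟ s ⌋)) (rows-once i s)) ⟩
    sumFin {k} (λ _ → 1)
      ≡⟨ trans (sumFin-const k 1) (*-identityʳ k) ⟩
    k ∎
    where open ≡-Reasoning

  available-symbol : ∀ s → k + sumFin (λ j → bit (available R j s)) ≡ m
  available-symbol s = begin
    k + sumFin (λ j → bit (available R j s))
      ≡⟨ cong (_+ sumFin (λ j → bit (available R j s))) (sym (used-symbol s)) ⟩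
    sumFin (λ j → used R j s) + sumFin (λ j → bit (available R j s))
      ≡⟨ sym (sumFin-+ (λ j → used R j s) _) ⟩
    sumFin (λ j → used R j s + bit (available R j s))
      ≡⟨ sumFin-cong (λ j → bit-available j s) ⟩
    sumFin {m} (λ _ → 1)
      ≡⟨ trans (sumFin-const m 1) (*-identityʳ m) ⟩
    m ∎
    where open ≡-Reasoning

cons : ∀ {k m} → (Fin m → Fin m) → Rectangle k m → Rectangle (suc k) m
cons σ R zero    = σ
cons σ R (suc i) = R i

cons-latin : ∀ {k m} {R : Rectangle k m} {σ} → IsLatinRectangle R → IsMatching (available R) σ → IsLatinRectangle (cons σ R)
cons-latin {R = R} {σ} latin (avail , inj) = record
  { rows-once    = λ { zero s → injective⇒fibres≡1 σ inj s ; (suc i) s → rows-once i s }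
  ; columns-once = once
  }
  where
  open IsLatinRectangle latin
  isZero⇒≡0 : ∀ n → isZero n ≡ true → n ≡ 0
  isZero⇒≡0 zero _ = refl
  once : ∀ j s → bit ⌊ σ j ≟ s ⌋ + used R j s ≤ 1
  once j s with σ j ≟ s
  ... | no  _    = columns-once j s
  ... | yes refl = ≤-reflexive (cong suc (isZero⇒≡0 _ (avail j)))

rectangles : ∀ k m → List (Rectangle k m)
rectangles zero    m = [ (λ ()) ]
rectangles (suc k) m = concat (map (λ R → map (λ σ → cons σ R) (matchings (available R))) (rectangles k m))

rectangles-latin : ∀ k m → All IsLatinRectangle (rectangles k m)
rectangles-latin zero    m = record { rows-once = λ () ; columns-once = λ _ _ → z≤n } ∷ []
rectangles-latin (suc k) m = All.concat⁺ (All.map⁺ (All.map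
  (λ {R} latin → All.map⁺ (All.map (cons-latin latin) (matchings-sound (available R)))) (rectangles-latin k m)))

DistinctRectangles : ∀ {k m} → Rectangle k m → Rectangle k m → Set
DistinctRectangles R R′ = ∃ λ i → ∃ λ j → R i j ≢ R′ i j

rectangles-distinct : ∀ k m → AllPairs DistinctRectangles (rectangles k m)
rectangles-distinct zero    m = [] ∷ []
rectangles-distinct (suc k) m = AllPairs.concat⁺
  (All.map⁺ (All.universal (λ R → AllPairs.map⁺ (AllPairs.map (λ { (j , ≢) → zero , j , ≢ }) (matchings-distinct (available R)))) _))
  (AllPairs.map⁺ (AllPairs.map (λ { (i , j , ≢) → All.map⁺ (All.universal (λ σ → All.map⁺ (All.universal (λ τ → suc i , j , ≢) _)) _) })
    (rectangles-distinct k m)))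

length-concat-bound : ∀ {X Y : Set} {P : X → Set} (f : X → List Y) {b c} → (∀ {x} → P x → b ≤ c * length (f x)) →
  ∀ {xs} → All P xs → length xs * b ≤ c * length (concat (map f xs))
length-concat-bound f bound [] = z≤n
length-concat-bound f {b} {c} bound {x ∷ xs} (p ∷ ps) = ≤-trans (+-mono-≤ (bound p) (length-concat-bound f {b} {c} bound ps))
  (≤-reflexive (trans (sym (*-distribˡ-+ c (length (f x)) _)) (cong (c *_) (sym (length-++ (f x))))))

^-*-distribʳ : ∀ a b n → (a * b) ^ n ≡ a ^ n * b ^ n
^-*-distribʳ a b zero    = refl
^-*-distribʳ a b (suc n) = trans (cong (a * b *_) (^-*-distribʳ a b n)) (lemma a b (a ^ n) (b ^ n))
  where
  lemma : ∀ a b x y → a * b * (x * y) ≡ a * x * (b * y)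
  lemma = solve-∀

-- The product of the extension factors: their parts (m - i)^m for i < k telescope to (m! / r!)^m,
-- where r is the number of rows still missing.
rectangles-bound : ∀ m k r → k + r ≡ m →
  (m !) ^ m * (m !) ^ k ≤ length (rectangles k m) * (m ^ m) ^ k * (r !) ^ m
rectangles-bound m zero    r refl = ≤-reflexive (lemma ((r !) ^ r))
  where
  lemma : ∀ x → x * 1 ≡ 1 * 1 * x
  lemma = solve-∀
rectangles-bound m (suc k) r eq = begin
  (m !) ^ m * (m ! * (m !) ^ k)                             ≡⟨ lemma₁ ((m !) ^ m) (m !) ((m !) ^ k) ⟩
  (m !) ^ m * (m !) ^ k * m !                               ≤⟨ *-monoˡ-≤ (m !) (rectangles-bound m k (suc r) eq′) ⟩
  ℓ * (m ^ m) ^ k * (suc r !) ^ m * m !                     ≡⟨ cong (λ t → ℓ * (m ^ m) ^ k * t * m !) (^-*-distribʳ (suc r) (r !) m) ⟩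
  ℓ * (m ^ m) ^ k * (suc r ^ m * (r !) ^ m) * m !           ≡⟨ lemma₂ ℓ ((m ^ m) ^ k) (suc r ^ m) ((r !) ^ m) (m !) ⟩
  ℓ * (suc r ^ m * m !) * ((m ^ m) ^ k * (r !) ^ m)         ≤⟨ *-monoˡ-≤ ((m ^ m) ^ k * (r !) ^ m)
                                                                (length-concat-bound extensions {c = m ^ m} extension-bound (rectangles-latin k m)) ⟩
  m ^ m * ℓ′ * ((m ^ m) ^ k * (r !) ^ m)                    ≡⟨ lemma₃ (m ^ m) ℓ′ ((m ^ m) ^ k) ((r !) ^ m) ⟩
  ℓ′ * (m ^ m * (m ^ m) ^ k) * (r !) ^ m                    ∎
  where
  open ≤-Reasoning
  ℓ = length (rectangles k m)
  ℓ′ = length (rectangles (suc k) m)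
  extensions : Rectangle k m → List (Rectangle (suc k) m)
  extensions R = map (λ σ → cons σ R) (matchings (available R))
  eq′ : k + suc r ≡ m
  eq′ = trans (+-suc k r) eq
  extension-bound : ∀ {R} → IsLatinRectangle R → suc r ^ m * m ! ≤ m ^ m * length (extensions R)
  extension-bound {R} latin = subst (λ l → suc r ^ m * m ! ≤ m ^ m * l) (sym (length-map _ (matchings (available R))))
    (matchings-bound (suc r) (available R)
      (λ s → +-cancelˡ-≡ k _ _ (trans (available-symbol s) (sym eq′)))
      (λ j → +-cancelˡ-≡ k _ _ (trans (available-column j) (sym eq′))))
    where open IsLatinRectangle latin
  lemma₁ : ∀ a b c → a * (b * c) ≡ a * c * b
  lemma₁ = solve-∀
  lemma₂ : ∀ l x s f b → l * x * (s * f) * b ≡ l * (s * b) * (x * f)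
  lemma₂ = solve-∀
  lemma₃ : ∀ a l x f → a * l * (x * f) ≡ l * (a * x) * f
  lemma₃ = solve-∀

-- Blowing up the cyclic latin square

sumFin-++ : ∀ m {k} (f : Fin (m + k) → ℕ) → sumFin f ≡ sumFin (λ i → f (i ↑ˡ k)) + sumFin (λ j → f (m ↑ʳ j))
sumFin-++ zero    f = refl
sumFin-++ (suc m) f = trans (cong (f zero +_) (sumFin-++ m (f ∘ suc))) (sym (+-assoc (f zero) _ _))

sumFin-combine : ∀ q {m} (f : Fin (q * m) → ℕ) → sumFin f ≡ sumFin {q} (λ b → sumFin {m} (λ r → f (combine b r)))
sumFin-combine zero        f = refl
sumFin-combine (suc q) {m} f = trans (sumFin-++ m f) (cong (sumFin (λ r → f (r ↑ˡ (q * m))) +_) (sumFin-combine q (λ i → f (m ↑ʳ i))))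

sumFin-toℕ : ∀ q → 2 * sumFin {q} toℕ + q ≡ q * q
sumFin-toℕ zero    = refl
sumFin-toℕ (suc q) = trans (cong (λ t → 2 * t + suc q) (trans (sumFin-+ {q} (λ _ → 1) toℕ) (cong (_+ sumFin {q} toℕ) (trans (sumFin-const q 1) (*-identityʳ q)))))
  (trans (lemma q (sumFin {q} toℕ)) (trans (cong (λ t → t + (2 * q + 1)) (sumFin-toℕ q)) (lemma′ q)))
  where
  lemma : ∀ q s → 2 * (q + s) + (1 + q) ≡ 2 * s + q + (2 * q + 1)
  lemma = solve-∀
  lemma′ : ∀ q → q * q + (2 * q + 1) ≡ (1 + q) * (1 + q)
  lemma′ = solve-∀

module BlowUp (q m : ℕ) .{{_ : NonZero q}} where

  n = q * m

  block : Fin n → Fin q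
  block i = quotient {q} m i

  inner : Fin n → Fin m
  inner i = remainder {q} m i

  _⊕_ : Fin q → Fin q → Fin q
  i ⊕ j = (toℕ i + toℕ j) mod q

  toℕ-⊕ : ∀ i j → toℕ (i ⊕ j) ≡ (toℕ i + toℕ j) % q
  toℕ-⊕ i j = toℕ-fromℕ< (m%n<n (toℕ i + toℕ j) q)

  ⊕-comm : ∀ i j → i ⊕ j ≡ j ⊕ i
  ⊕-comm i j = toℕ-injective (trans (toℕ-⊕ i j) (trans (cong (_% q) (+-comm (toℕ i) (toℕ j))) (sym (toℕ-⊕ j i))))

  ⊕-recover : ∀ i j → toℕ j ≡ ((q ∸ toℕ i) % q + toℕ (i ⊕ j)) % q
  ⊕-recover i j = sym (begin
    ((q ∸ toℕ i) % q + toℕ (i ⊕ j)) % q              ≡⟨ cong (λ t → ((q ∸ toℕ i) % q + t) % q) (toℕ-⊕ i j) ⟩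
    ((q ∸ toℕ i) % q + (toℕ i + toℕ j) % q) % q      ≡⟨ sym (%-distribˡ-+ (q ∸ toℕ i) (toℕ i + toℕ j) q) ⟩
    (q ∸ toℕ i + (toℕ i + toℕ j)) % q                ≡⟨ cong (_% q) (trans (sym (+-assoc (q ∸ toℕ i) (toℕ i) (toℕ j)))
                                                          (trans (cong (_+ toℕ j) (m∸n+n≡m (<⇒≤ (toℕ<n i)))) (+-comm q (toℕ j)))) ⟩
    (toℕ j + q) % q                                  ≡⟨ [m+n]%n≡m%n (toℕ j) q ⟩
    toℕ j % q                                        ≡⟨ m<n⇒m%n≡m (toℕ<n j) ⟩
    toℕ j ∎)
    where open ≡-Reasoning

  ⊕-cancelˡ : ∀ i {j k} → i ⊕ j ≡ i ⊕ k → j ≡ k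
  ⊕-cancelˡ i {j} {k} eq = toℕ-injective (trans (⊕-recover i j)
    (trans (cong (λ t → ((q ∸ toℕ i) % q + toℕ t) % q) eq) (sym (⊕-recover i k))))

  ⊕-cancelʳ : ∀ k {i j} → i ⊕ k ≡ j ⊕ k → i ≡ j
  ⊕-cancelʳ k {i} {j} eq = ⊕-cancelˡ k (trans (⊕-comm k i) (trans eq (⊕-comm j k)))

  index-ext : ∀ {i j : Fin n} → block i ≡ block j → inner i ≡ inner j → i ≡ j
  index-ext {i} {j} eq eq′ = trans (sym (combine-remQuot {q} m i)) (trans (cong₂ combine eq eq′) (combine-remQuot {q} m j))

  module _ (S : Fin q → Fin q → Array m) where

    blowUp : Array n
    blowUp i j = combine (block i ⊕ block j) (S (block i) (block j) (inner i) (inner j))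

    blowUp-latin : (∀ b c → IsLatin (S b c)) → IsLatin blowUp
    blowUp-latin latin = (λ i → injective⇒fibres≡1 (blowUp i) (row-injective i)) ,
                         (λ j → injective⇒fibres≡1 (λ i → blowUp i j) (column-injective j))
      where
      row-injective : ∀ i {j j′} → blowUp i j ≡ blowUp i j′ → j ≡ j′
      row-injective i {j} {j′} eq with combine-injective (block i ⊕ block j) _ (block i ⊕ block j′) _ eq
      ... | eq₁ , eq₂ = index-ext blocks (count≤1⇒unique {p = λ r → ⌊ S (block i) (block j) (inner i) r ≟ S (block i) (block j) (inner i) (inner j) ⌋}
          (≤-reflexive (proj₁ (latin (block i) (block j)) (inner i) _))
          (true-⌊⌋ {p? = _ ≟ _} refl)
          (true-⌊⌋ {p? = _ ≟ _} (trans (cong (λ b → S (block i) b (inner i) (inner j′)) blocks) (sym eq₂))))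
        where
        blocks : block j ≡ block j′
        blocks = ⊕-cancelˡ (block i) eq₁
      column-injective : ∀ j {i i′} → blowUp i j ≡ blowUp i′ j → i ≡ i′
      column-injective j {i} {i′} eq with combine-injective (block i ⊕ block j) _ (block i′ ⊕ block j) _ eq
      ... | eq₁ , eq₂ = index-ext blocks (count≤1⇒unique {p = λ r → ⌊ S (block i) (block j) r (inner j) ≟ S (block i) (block j) (inner i) (inner j) ⌋}
          (≤-reflexive (proj₂ (latin (block i) (block j)) (inner j) _))
          (true-⌊⌋ {p? = _ ≟ _} refl)
          (true-⌊⌋ {p? = _ ≟ _} (trans (cong (λ b → S b (block j) (inner i′) (inner j)) blocks) (sym eq₂))))
        where
        blocks : block i ≡ block i′
        blocks = ⊕-cancelʳ (block j) eq₁

    weight : Fin n → ℕ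
    weight i = toℕ (block i)

    weight-blowUp : ∀ i j → weight i + weight j ≡ weight (blowUp i j) + q * ((weight i + weight j) / q)
    weight-blowUp i j = trans (m≡m%n+[m/n]*n (weight i + weight j) q) (cong₂ _+_
      (sym (trans (cong toℕ (cong proj₁ (remQuot-combine (block i ⊕ block j) _))) (toℕ-⊕ (block i) (block j))))
      (*-comm ((weight i + weight j) / q) q))

    total-weight : 2 * sumFin weight + m * q ≡ m * (q * q)
    total-weight = begin
      2 * sumFin weight + m * q
        ≡⟨ cong (λ t → 2 * t + m * q) (trans (sumFin-combine q weight) (trans
             (sumFin-cong {q} λ b → trans (sumFin-cong {m} λ r → cong (toℕ ∘ proj₁) (remQuot-combine b r)) (sumFin-const m (toℕ b)))
             (sumFin-*ˡ {q} m toℕ))) ⟩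
      2 * (m * sumFin {q} toℕ) + m * q
        ≡⟨ lemma m (sumFin {q} toℕ) q ⟩
      m * (2 * sumFin {q} toℕ + q)
        ≡⟨ cong (m *_) (sumFin-toℕ q) ⟩
      m * (q * q) ∎
      where
      open ≡-Reasoning
      lemma : ∀ m s q → 2 * (m * s) + m * q ≡ m * (2 * s + q)
      lemma = solve-∀

    module _ {k : ℕ} {P : Fin n → Fin n → Bool} (plex : IsPlex blowUp k P) where

      T = sumFin weight

      sum-rows : sumFin (λ i → sumFin (λ j → bit (P i j) * weight i)) ≡ k * T
      sum-rows = trans (sumFin-cong λ i → trans (sumFin-cong λ j → *-comm (bit (P i j)) (weight i))
          (trans (sumFin-*ˡ (weight i) (λ j → bit (P i j))) (trans (cong (weight i *_)
            (trans (sym (count-sumFin (P i))) (proj₁ plex i))) (*-comm (weight i) k))))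
        (sumFin-*ˡ k weight)

      sum-columns : sumFin (λ i → sumFin (λ j → bit (P i j) * weight j)) ≡ k * T
      sum-columns = trans (sumFin-comm λ i j → bit (P i j) * weight j)
        (trans (sumFin-cong λ j → trans (sumFin-cong λ i → *-comm (bit (P i j)) (weight j))
          (trans (sumFin-*ˡ (weight j) (λ i → bit (P i j))) (trans (cong (weight j *_)
            (trans (sym (count-sumFin (λ i → P i j))) (proj₁ (proj₂ plex) j))) (*-comm (weight j) k))))
        (sumFin-*ˡ k weight))

      -- Spreads the weight of the symbol in a chosen cell over all symbols, so that after
      -- exchanging sums the symbol condition of `IsPlex` can be inserted.
      select : ∀ b (t : Fin n) → bit b * weight t ≡ sumFin (λ s → weight s * bit (b ∧ ⌊ t ≟ s ⌋))
      select false t = sym (trans (sumFin-cong λ s → *-zeroʳ (weight s)) (trans (sumFin-const n 0) (*-zeroʳ n)))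
      select true  t = begin
        1 * weight t                                         ≡⟨ cong (_* weight t) (sym (count-≟ t)) ⟩
        count (λ s → ⌊ t ≟ s ⌋) * weight t                   ≡⟨ *-comm _ (weight t) ⟩
        weight t * count (λ s → ⌊ t ≟ s ⌋)                   ≡⟨ cong (weight t *_) (count-sumFin λ s → ⌊ t ≟ s ⌋) ⟩
        weight t * sumFin (λ s → bit ⌊ t ≟ s ⌋)              ≡⟨ sym (sumFin-*ˡ (weight t) λ s → bit ⌊ t ≟ s ⌋) ⟩
        sumFin (λ s → weight t * bit ⌊ t ≟ s ⌋)              ≡⟨ sumFin-cong pointwise ⟩
        sumFin (λ s → weight s * bit (true ∧ ⌊ t ≟ s ⌋))     ∎
        where
        open ≡-Reasoning
        pointwise : ∀ s → weight t * bit ⌊ t ≟ s ⌋ ≡ weight s * bit ⌊ t ≟ s ⌋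
        pointwise s with t ≟ s
        ... | yes refl = refl
        ... | no  _    = trans (*-zeroʳ (weight t)) (sym (*-zeroʳ (weight s)))

      sum-symbols : sumFin (λ i → sumFin (λ j → bit (P i j) * weight (blowUp i j))) ≡ k * T
      sum-symbols = begin
        sumFin (λ i → sumFin (λ j → bit (P i j) * weight (blowUp i j)))
          ≡⟨ sumFin-cong (λ i → trans (sumFin-cong λ j → select (P i j) (blowUp i j)) (sumFin-comm λ j s → weight s * hit i j s)) ⟩
        sumFin (λ i → sumFin (λ s → sumFin (λ j → weight s * hit i j s)))
          ≡⟨ sumFin-comm (λ i s → sumFin (λ j → weight s * hit i j s)) ⟩
        sumFin (λ s → sumFin (λ i → sumFin (λ j → weight s * hit i j s)))
          ≡⟨ sumFin-cong (λ s → trans (sumFin-cong λ i → sumFin-*ˡ (weight s) (λ j → hit i j s)) (trans (sumFin-*ˡ (weight s) (λ i → sumFin (λ j → hit i j s)))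
               (trans (cong (weight s *_) (trans (sumFin-cong λ i → sym (count-sumFin (λ j → P i j ∧ ⌊ blowUp i j ≟ s ⌋))) (proj₂ (proj₂ plex) s))) (*-comm (weight s) k)))) ⟩
        sumFin (λ s → k * weight s)
          ≡⟨ sumFin-*ˡ k weight ⟩
        k * T ∎
        where
        open ≡-Reasoning
        hit : Fin n → Fin n → Fin n → ℕ
        hit i j s = bit (P i j ∧ ⌊ blowUp i j ≟ s ⌋)

      -- Two block numbers add up to less than 2 q, so the quotient is 0 or 1, and this is the
      -- number of chosen cells where the addition modulo q wraps round.
      carries : ℕ
      carries = sumFin (λ i → sumFin (λ j → bit (P i j) * ((weight i + weight j) / q)))

      weight-divisible : k * T ≡ q * carries
      weight-divisible = +-cancelˡ-≡ (k * T) _ _ (begin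
        k * T + k * T
          ≡⟨ sym (cong₂ _+_ sum-rows sum-columns) ⟩
        sumFin (λ i → sumFin (λ j → bit (P i j) * weight i)) + sumFin (λ i → sumFin (λ j → bit (P i j) * weight j))
          ≡⟨ sum₂-+ (λ i j → bit (P i j) * weight i) (λ i j → bit (P i j) * weight j) ⟩
        sumFin (λ i → sumFin (λ j → bit (P i j) * weight i + bit (P i j) * weight j))
          ≡⟨ sumFin-cong (λ i → sumFin-cong λ j → pointwise i j) ⟩
        sumFin (λ i → sumFin (λ j → bit (P i j) * weight (blowUp i j) + q * (bit (P i j) * ((weight i + weight j) / q))))
          ≡⟨ sym (sum₂-+ (λ i j → bit (P i j) * weight (blowUp i j)) (λ i j → q * (bit (P i j) * ((weight i + weight j) / q)))) ⟩
        sumFin (λ i → sumFin (λ j → bit (P i j) * weight (blowUp i j))) + sumFin (λ i → sumFin (λ j → q * (bit (P i j) * ((weight i + weight j) / q))))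
          ≡⟨ cong₂ _+_ sum-symbols (trans (sumFin-cong λ i → sumFin-*ˡ q (λ j → bit (P i j) * ((weight i + weight j) / q)))
               (sumFin-*ˡ q (λ i → sumFin (λ j → bit (P i j) * ((weight i + weight j) / q))))) ⟩
        k * T + q * carries ∎)
        where
        open ≡-Reasoning
        sum₂-+ : (f g : Fin n → Fin n → ℕ) → sumFin (λ i → sumFin (λ j → f i j)) + sumFin (λ i → sumFin (λ j → g i j)) ≡
                 sumFin (λ i → sumFin (λ j → f i j + g i j))
        sum₂-+ f g = sym (trans (sumFin-cong λ i → sumFin-+ (f i) (g i)) (sumFin-+ (λ i → sumFin (f i)) (λ i → sumFin (g i))))
        lemma : ∀ b w c → b * (w + q * c) ≡ b * w + q * (b * c)
        lemma b w c = trans (*-distribˡ-+ b w (q * c)) (cong (b * w +_) (trans (sym (*-assoc b q c)) (trans (cong (_* c) (*-comm b q)) (*-assoc q b c))))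
        pointwise : ∀ i j → bit (P i j) * weight i + bit (P i j) * weight j ≡
          bit (P i j) * weight (blowUp i j) + q * (bit (P i j) * ((weight i + weight j) / q))
        pointwise i j = trans (sym (*-distribˡ-+ (bit (P i j)) (weight i) (weight j)))
          (trans (cong (bit (P i j) *_) (weight-blowUp i j)) (lemma (bit (P i j)) _ _))

      -- Since 2 T = m q (q - 1), the relation k T = q · `carries` becomes k m (q - 1) = 2 ·
      -- `carries` once q is cancelled; it is written without subtraction. For even q and odd k m
      -- the two sides have different parity.
      plex-parity : 2 * carries + k * m ≡ k * m * q
      plex-parity = *-cancelˡ-≡ _ _ q (begin
        q * (2 * carries + k * m)       ≡⟨ lemma₁ q carries k m ⟩
        2 * (q * carries) + k * m * q   ≡⟨ cong (λ t → 2 * t + k * m * q) (sym weight-divisible) ⟩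
        2 * (k * T) + k * m * q         ≡⟨ lemma₂ k T m q ⟩
        k * (2 * T + m * q)             ≡⟨ cong (k *_) total-weight ⟩
        k * (m * (q * q))               ≡⟨ lemma₃ k m q ⟩
        q * (k * m * q)                 ∎)
        where
        open ≡-Reasoning
        lemma₁ : ∀ q c k m → q * (2 * c + k * m) ≡ 2 * (q * c) + k * m * q
        lemma₁ = solve-∀
        lemma₂ : ∀ k T m q → 2 * (k * T) + k * m * q ≡ k * (2 * T + m * q)
        lemma₂ = solve-∀
        lemma₃ : ∀ k m q → k * (m * (q * q)) ≡ q * (k * m * q)
        lemma₃ = solve-∀

    blowUp-noOddPlex : ∀ {q′} → q ≡ 2 * q′ → Odd m → NoOddPlex blowUp
    blowUp-noOddPlex {q′} q≡2q′ (u , m≡) k P (t , k≡) plex = even≢odd (k * m * q′) (carries plex + (2 * (t * u) + t + u)) (begin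
      2 * (k * m * q′)                                    ≡⟨ lemma₁ (k * m) q′ ⟩
      k * m * (2 * q′)                                    ≡⟨ cong (k * m *_) (sym q≡2q′) ⟩
      k * m * q                                           ≡⟨ sym (plex-parity plex) ⟩
      2 * carries plex + k * m                            ≡⟨ cong₂ (λ k m → 2 * carries plex + k * m) k≡ m≡ ⟩
      2 * carries plex + suc (2 * t) * suc (2 * u)        ≡⟨ lemma₂ (carries plex) t u ⟩
      suc (2 * (carries plex + (2 * (t * u) + t + u)))    ∎)
      where
      open ≡-Reasoning
      lemma₁ : ∀ x q → 2 * (x * q) ≡ x * (2 * q)
      lemma₁ = solve-∀
      lemma₂ : ∀ c t u → 2 * c + (1 + 2 * t) * (1 + 2 * u) ≡ 1 + 2 * (c + (2 * (t * u) + t + u))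
      lemma₂ = solve-∀

-- The family of squares indexed by the choices in the blocks

lookup-AllPairs : ∀ {X : Set} {R : X → X → Set} → (∀ {x y} → R x y → R y x) → ∀ {xs} → AllPairs R xs →
                  ∀ {i j} → i ≢ j → R (lookup xs i) (lookup xs j)
lookup-AllPairs sym-R (px ∷ pxs) {zero}  {zero}  i≢j = contradiction refl i≢j
lookup-AllPairs sym-R (px ∷ pxs) {zero}  {suc j} i≢j = All.lookup px (∈-lookup j)
lookup-AllPairs sym-R (px ∷ pxs) {suc i} {zero}  i≢j = sym-R (All.lookup px (∈-lookup i))
lookup-AllPairs sym-R (px ∷ pxs) {suc i} {suc j} i≢j = lookup-AllPairs sym-R pxs (i≢j ∘ cong suc)

latinCount : ℕ → ℕ
latinCount m = length (rectangles m m)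

latinSquare : ∀ m → Fin (latinCount m) → Array m
latinSquare m = lookup (rectangles m m)

latinSquare-latin : ∀ m x → IsLatin (latinSquare m x)
latinSquare-latin m x = rows-once , λ j → sumFin-full (used L j) (columns-once j) (sumFin-fibres λ i → L i j)
  where
  L = latinSquare m x
  open IsLatinRectangle (All.lookup (rectangles-latin m m) (∈-lookup x))

latinSquare-distinct : ∀ m {x y} → x ≢ y → Distinct (latinSquare m x) (latinSquare m y)
latinSquare-distinct m = lookup-AllPairs (λ { (i , j , ≢) → i , j , ≢ ∘ sym }) (rectangles-distinct m m)

latinCount-bound : ∀ m → (m !) ^ m * (m !) ^ m ≤ latinCount m * (m ^ m) ^ m
latinCount-bound m = ≤-trans (rectangles-bound m m 0 (+-identityʳ m))
  (≤-reflexive (trans (cong (latinCount m * (m ^ m) ^ m *_) (^-zeroˡ m)) (*-identityʳ _)))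

funToFin-cong : ∀ {k n} {f g : Fin k → Fin n} → f ≗ g → funToFin f ≡ funToFin g
funToFin-cong {zero}  f≗g = refl
funToFin-cong {suc k} f≗g = cong₂ combine (f≗g zero) (funToFin-cong (f≗g ∘ suc))

finToFun-separates : ∀ {N k} {x y : Fin (N ^ k)} → x ≢ y → ∃ λ c → finToFun {N} {k} x c ≢ finToFun {N} {k} y c
finToFun-separates {N} {k} {x} {y} x≢y = ¬∀⟶∃¬ k _ (λ c → finToFun {N} {k} x c ≟ finToFun {N} {k} y c) λ eq →
  x≢y (trans (sym (funToFin-finToFin {k} {N} x)) (trans (funToFin-cong eq) (funToFin-finToFin {k} {N} y)))

module Family (q m : ℕ) .{{_ : NonZero q}} where
  open BlowUp q m

  -- The index `x` is read as a number of q² digits in base `latinCount m`, one digit for each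
  -- block; the digit selects the square that fills it.
  cells : Fin (latinCount m ^ (q * q)) → Fin q → Fin q → Array m
  cells x b c = latinSquare m (finToFun {latinCount m} {q * q} x (combine b c))

  square : Fin (latinCount m ^ (q * q)) → Array n
  square x = blowUp (cells x)

  square-distinct : ∀ x y → x ≢ y → Distinct (square x) (square y)
  square-distinct x y x≢y with finToFun-separates {latinCount m} {q * q} x≢y
  ... | e , differ with latinSquare-distinct m differ
  ... | r , s , differ′ = i , j , λ eq → differ′ (trans (sym (value x)) (trans (combine-injectiveʳ (block i ⊕ block j) _ (block i ⊕ block j) _ eq) (value y)))
    where
    b c : Fin q
    b = quotient {q} q e
    c = remainder {q} q e
    i j : Fin n
    i = combine b r
    j = combine c s
    value : ∀ z → cells z (block i) (block j) (inner i) (inner j) ≡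
      latinSquare m (finToFun {latinCount m} {q * q} z e) r s
    value z = at (cong proj₁ (remQuot-combine b r)) (cong proj₁ (remQuot-combine c s))
                 (cong proj₂ (remQuot-combine b r)) (cong proj₂ (remQuot-combine c s))
      where
      at : ∀ {b′ c′ r′ s′} → b′ ≡ b → c′ ≡ c → r′ ≡ r → s′ ≡ s →
        cells z b′ c′ r′ s′ ≡ latinSquare m (finToFun {latinCount m} {q * q} z e) r s
      at refl refl refl refl = cong (λ e → latinSquare m (finToFun {latinCount m} {q * q} z e) r s) (combine-remQuot {q} q e)

-- Factorial estimates and the exponential series

expScaled-lower : ∀ x K → x ^ K ≤ expScaled x K
expScaled-lower x zero    = ≤-refl
expScaled-lower x (suc K) = m≤n+m (x ^ suc K) (suc K * expScaled x K)

!-+-bound : ∀ y w → (y + w) ! ≤ w ! * (y + w) ^ y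
!-+-bound zero    w = ≤-reflexive (sym (*-identityʳ (w !)))
!-+-bound (suc y) w = begin
  suc (y + w) * (y + w) !                       ≤⟨ *-monoʳ-≤ (suc (y + w)) (!-+-bound y w) ⟩
  suc (y + w) * (w ! * (y + w) ^ y)             ≤⟨ *-monoʳ-≤ (suc (y + w)) (*-monoʳ-≤ (w !) (^-monoˡ-≤ y (n≤1+n (y + w)))) ⟩
  suc (y + w) * (w ! * suc (y + w) ^ y)         ≡⟨ lemma (suc (y + w)) (w !) _ ⟩
  w ! * (suc (y + w) * suc (y + w) ^ y)         ∎
  where
  open ≤-Reasoning
  lemma : ∀ a b c → a * (b * c) ≡ b * (a * c)
  lemma = solve-∀

-- The multinomial coefficient (m y)! / (m!)^y counts distributions of m y objects into y boxes of
-- size m, at most y^(m y). It relates the K! of the scaled exponential series to powers of m!.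
!-*-bound : ∀ m y → (m * y) ! ≤ (m !) ^ y * y ^ (m * y)
!-*-bound zero    y = ≤-reflexive (sym (trans (*-identityʳ (1 ^ y)) (^-zeroˡ y)))
!-*-bound (suc m) y = begin
  (y + m * y) !                                             ≤⟨ !-+-bound y (m * y) ⟩
  (m * y) ! * (suc m * y) ^ y                               ≤⟨ *-monoˡ-≤ ((suc m * y) ^ y) (!-*-bound m y) ⟩
  (m !) ^ y * y ^ (m * y) * (suc m * y) ^ y                 ≡⟨ cong ((m !) ^ y * y ^ (m * y) *_) (^-*-distribʳ (suc m) y y) ⟩
  (m !) ^ y * y ^ (m * y) * (suc m ^ y * y ^ y)             ≡⟨ lemma ((m !) ^ y) (y ^ (m * y)) (suc m ^ y) (y ^ y) ⟩
  suc m ^ y * (m !) ^ y * (y ^ y * y ^ (m * y))             ≡⟨ sym (cong₂ _*_ (^-*-distribʳ (suc m) (m !) y) (^-distribˡ-+-* y y (m * y))) ⟩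
  (suc m !) ^ y * y ^ (y + m * y)                           ∎
  where
  open ≤-Reasoning
  lemma : ∀ f p s z → f * p * (s * z) ≡ s * f * (z * p)
  lemma = solve-∀

-- The last term x ^ K / K! of the partial sum with K = x = 2 n² suffices.
count-bound : ∀ q m → let n = q * m in
  AtLeastOverExp (latinCount m ^ (q * q)) (m ^ (n * n)) (2 * (n * n))
count-bound q m = K , (begin
  m ^ (n * n) * K !                         ≡⟨ cong (λ k → m ^ (n * n) * k !) K≡my ⟩
  m ^ (n * n) * (m * y) !                   ≤⟨ *-monoʳ-≤ (m ^ (n * n)) (!-*-bound m y) ⟩
  m ^ (n * n) * ((m !) ^ y * y ^ (m * y))   ≤⟨ *-monoʳ-≤ (m ^ (n * n)) (*-monoˡ-≤ (y ^ (m * y)) blocks) ⟩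
  m ^ (n * n) * (N * m ^ (n * n) * y ^ (m * y))
                                            ≡⟨ lemma (m ^ (n * n)) N (y ^ (m * y)) ⟩
  N * (m ^ (n * n) * m ^ (n * n) * y ^ (m * y))
                                            ≡⟨ cong (N *_) powers ⟩
  N * K ^ K                                 ≤⟨ *-monoʳ-≤ N (expScaled-lower K K) ⟩
  N * expScaled K K                         ∎)
  where
  open ≤-Reasoning
  n = q * m
  K = 2 * (n * n)
  -- Chosen so that K = m y and so that (m!)^y is the q²-th power of (m!)^(2m), the quantity in the
  -- lower bound for the number of latin squares of order m.
  y = 2 * m * (q * q)
  N = latinCount m ^ (q * q)
  K≡my : K ≡ m * y
  K≡my = lemma′ q m
    where
    lemma′ : ∀ q m → 2 * (q * m * (q * m)) ≡ m * (2 * m * (q * q))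
    lemma′ = solve-∀
  lemma : ∀ a N b → a * (N * a * b) ≡ N * (a * a * b)
  lemma = solve-∀
  n*n : m * m * (q * q) ≡ n * n
  n*n = lemma′ q m
    where
    lemma′ : ∀ q m → m * m * (q * q) ≡ q * m * (q * m)
    lemma′ = solve-∀
  powers : m ^ (n * n) * m ^ (n * n) * y ^ (m * y) ≡ K ^ K
  powers = trans (cong (_* y ^ (m * y)) (trans (sym (^-distribˡ-+-* m (n * n) (n * n)))
      (cong (m ^_) (trans (cong (n * n +_) (sym (+-identityʳ (n * n)))) K≡my))))
    (trans (sym (^-*-distribʳ m y (m * y))) (sym (cong (λ k → k ^ k) K≡my)))
  blocks : (m !) ^ y ≤ N * m ^ (n * n)
  blocks = begin
    (m !) ^ y                                         ≡⟨ sym (^-*-assoc (m !) (2 * m) (q * q)) ⟩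
    ((m !) ^ (2 * m)) ^ (q * q)                       ≡⟨ cong (_^ (q * q)) (trans (^-distribˡ-+-* (m !) m (m + 0))
                                                           (cong (λ t → (m !) ^ m * (m !) ^ t) (+-identityʳ m))) ⟩
    ((m !) ^ m * (m !) ^ m) ^ (q * q)                 ≤⟨ ^-monoˡ-≤ (q * q) (latinCount-bound m) ⟩
    (latinCount m * (m ^ m) ^ m) ^ (q * q)            ≡⟨ ^-*-distribʳ (latinCount m) ((m ^ m) ^ m) (q * q) ⟩
    N * ((m ^ m) ^ m) ^ (q * q)                       ≡⟨ cong (λ t → N * t ^ (q * q)) (^-*-assoc m m m) ⟩
    N * (m ^ (m * m)) ^ (q * q)                       ≡⟨ cong (N *_) (trans (^-*-assoc m (m * m) (q * q)) (cong (m ^_) n*n)) ⟩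
    N * m ^ (n * n)                                   ∎

theorem2p1 : (a m : ℕ) → 1 ≤ a → 1 ≤ m → Odd m →
    let n = 2 ^ a * m in
    ∃ λ (N : ℕ) → ∃ λ (L : Fin N → Array n) →
    ((x y : Fin N) → x ≢ y → Distinct (L x) (L y)) ×
    ((x : Fin N) → IsLatin (L x) × NoOddPlex (L x)) ×
    AtLeastOverExp N (m ^ (n * n)) (2 * (n * n))
theorem2p1 (suc a) m 1≤a 1≤m odd-m =
  latinCount m ^ (q * q) , square , square-distinct ,
  -- The positive exponent makes q even: 2 ^ suc a unfolds to 2 * 2 ^ a, which is why `refl`
  -- suffices.
  (λ x → blowUp-latin (cells x) (λ b c → latinSquare-latin m _) , blowUp-noOddPlex (cells x) {q′ = 2 ^ a} refl odd-m) ,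
  count-bound q m
  where
  q : ℕ
  q = 2 ^ suc a
  instance
    q-nonZero : NonZero q
    q-nonZero = m^n≢0 2 (suc a)
  open BlowUp q m
  open Family q m
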